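{- For all $k, m \in \mathbb{N}$, $P_{DP}(K_1 \vee C_{2k+1}, m) = P(K_1 \vee C_{2k+1}, m)$, and \[ P_{DP}(K_1 \vee C_{2k+2}, m) = \begin{cases} 0 & \text{if } m \in \{1,2\},\\ 3 & \text{if } m = 3,\\ P(K_1 \vee C_{2k+2}, m) & \text{if } m \geq 4. \end{cases} \]
   Context: All graphs are finite and simple; $K_1 \vee H$ is the join of a single vertex with $H$ (the cone of $H$), and $C_n$ is the cycle on $n$ vertices. A cover of a graph $G$ is a pair $\mathcal{H}=(L,H)$ where $H$ is a graph and $L: V(G) \to \mathcal{P}(V(H))$ satisfies: (1) $\{L(u): u \in V(G)\}$ is a partition of $V(H)$ into $|V(G)|$ parts; (2) $H[L(u)]$ is complete for each $u$; (3) if there is an edge of $H$ between $L(u)$ and $L(v)$ with $u \neq v$, then $uv \in E(G)$; (4) if $uv \in E(G)$, the edges of $H$ between $L(u)$ and $L(v)$ form a (possibly empty) matching. The cover is $m$-fold if $|L(u)|=m$ for all $u$. An $\mathcal{H}$-coloring of $G$ is an independent set of $H$ of size $|V(G)|$. $P_{DP}(G,m)$ is the minimum number of $\mathcal{H}$-colorings of $G$ over all $m$-fold covers $\mathcal{H}$ of $G$. $P(G,m)$ is the chromatic polynomial of $G$. -}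

module Defs where

open import Data.Nat using (ℕ; zero; suc; _+_; _*_; _≤_; _%_; _≡ᵇ_)
open import Data.Fin using (Fin; zero; suc; toℕ; _≟_)
open import Data.Bool using (Bool; true; false; _∧_; _∨_; not; T)
open import Data.Vec using (Vec; lookup)
open import Data.Fin.Subset using (Subset; inside; ∣_∣)
open import Data.Product using (Σ; _×_)
open import Relation.Nullary using (¬_; does)
open import Relation.Binary.PropositionalEquality using (_≡_)
open import Function.Bundles using (_↔_)

record Graph : Set where
  field
    size : ℕ
    adj  : Fin size → Fin size → Bool
open Graph public

record SimpleGraph : Set where
  field
    graph  : Graph
    sym    : ∀ x y → adj graph x y ≡ adj graph y x
    irrefl : ∀ x → adj graph x x ≡ false
open SimpleGraph public

HasCard : Set → ℕ → Set
HasCard A p = Fin p ↔ A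

-- The cycle C_n on Fin n (i ~ j iff j ≡ i+1 mod n or i ≡ j+1 mod n,
-- with an i ≠ j guard; the guard is vacuous for n ≥ 3).

nextOf : (n : ℕ) → Fin n → Fin n → Bool
nextOf (suc n) i j = (suc (toℕ i) % suc n) ≡ᵇ toℕ j
nextOf zero () j

cycleAdj : (n : ℕ) → Fin n → Fin n → Bool
cycleAdj n i j = not (does (i ≟ j)) ∧ (nextOf n i j ∨ nextOf n j i)

Cycle : ℕ → Graph
Cycle n = record { size = n ; adj = cycleAdj n }

coneAdj : (G : Graph) → Fin (suc (size G)) → Fin (suc (size G)) → Bool
coneAdj G zero    zero    = false
coneAdj G zero    (suc j) = true
coneAdj G (suc i) zero    = true
coneAdj G (suc i) (suc j) = adj G i j

Cone : Graph → Graph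
Cone G = record { size = suc (size G) ; adj = coneAdj G }

-- Chromatic polynomial: P(G,m) = number of proper m-colourings
-- c : V(G) → {1..m} (colourings as vectors indexed by V(G)).
-- Properness is a Boolean test so that the subtype has unique proofs.

allFinB : (n : ℕ) → (Fin n → Bool) → Bool
allFinB zero    f = true
allFinB (suc n) f = f zero ∧ allFinB n (λ i → f (suc i))

isProper : (G : Graph) (m : ℕ) → Vec (Fin m) (size G) → Bool
isProper G m c = allFinB (size G) λ u → allFinB (size G) λ v →
  not (adj G u v ∧ does (lookup c u ≟ lookup c v))

ChromaticValue : Graph → ℕ → ℕ → Set
ChromaticValue G m p = HasCard (Σ (Vec (Fin m) (size G)) (λ c → T (isProper G m c))) p

-- DP covers.  H is a finite simple graph on Fin N; part : V(H) → V(G)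
-- sends each vertex of H to the u with x ∈ L(u), i.e. L(u) = part⁻¹(u).

record Cover (G : Graph) : Set where
  field
    H    : SimpleGraph
    part : Fin (size (graph H)) → Fin (size G)
  HV : Set
  HV = Fin (size (graph H))
  E : HV → HV → Bool
  E = adj (graph H)
  field
    complete : ∀ x y → part x ≡ part y → ¬ (x ≡ y) → E x y ≡ true
    respects : ∀ x y → ¬ (part x ≡ part y) → E x y ≡ true →
               adj G (part x) (part y) ≡ true
    matching : ∀ x y z → ¬ (part x ≡ part y) → part y ≡ part z →
               E x y ≡ true → E x z ≡ true → y ≡ z
open Cover public

-- (1) + m-fold: every L(u) has exactly m elements (this makes the
-- L(u) a partition of V(H) into |V(G)| parts).
MFold : {G : Graph} → ℕ → Cover G → Set
MFold {G} m 𝓗 = ∀ (u : Fin (size G)) → HasCard (Σ (HV 𝓗) (λ x → part 𝓗 x ≡ u)) m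

-- 𝓗-colourings of G: independent sets S of H with |S| = |V(G)|
-- (Boolean test, so the subtype of subsets has unique proofs).
isHColoring : {G : Graph} (𝓗 : Cover G) → Subset (size (graph (H 𝓗))) → Bool
isHColoring {G} 𝓗 S =
  (∣ S ∣ ≡ᵇ size G) ∧
  allFinB (size (graph (H 𝓗))) (λ x → allFinB (size (graph (H 𝓗))) (λ y →
    not (lookup S x ∧ lookup S y ∧ E 𝓗 x y)))

NumHColorings : {G : Graph} → Cover G → ℕ → Set
NumHColorings 𝓗 q = HasCard (Σ (Subset (size (graph (H 𝓗)))) (λ S → T (isHColoring 𝓗 S))) q

DPValue : Graph → ℕ → ℕ → Set
DPValue G m p =
  Σ (Cover G) (λ 𝓗 → MFold m 𝓗 × NumHColorings 𝓗 p) ×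
  (∀ (𝓗 : Cover G) (q : ℕ) → MFold m 𝓗 → NumHColorings 𝓗 q → p ≤ q)

{-# OPTIONS --safe #-}

-- Label an m-fold cover of the wheel so that colour x of the hub conflicts only with
-- colour x of every rim vertex, and extend the matchings of the rim edges to permutations
-- σ₀, …, σₙ₋₁.  The colourings with hub colour x are then at least as many as the closed
-- walks a₀, …, aₙ = a₀ with aᵢ ≢ x and aᵢ₊₁ ≢ σᵢ aᵢ.  If every σᵢ fixes x, the transfer
-- matrices on the s = m − 1 other colours have the form J − P, so their product is
-- cJ ± Π with Π a permutation matrix, and the number of walks is sc ± fix Π.  If some σᵢ
-- moves x, redirect σᵢ⁻¹ x to σᵢ x; this only removes walks.
--
-- For odd n the sign is negative and fix Π ≤ s gives the bound.  For even n let f be the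
-- number of colours fixed by all σᵢ.  A fixed x contributes at least sc + f − 1 walks; a
-- moved x contributes at least sc + f + c′, where c′ is the coefficient of J for n − 1
-- factors, because the pair (σᵢ⁻¹ x , σᵢ x) becomes available.  Summing over x gives the
-- chromatic value as soon as c′ ≥ s, that is for m ≥ 4, and gives 3 for m = 3.
module Submission where

open import Defs hiding (sym)
open import Data.Bool using (Bool; true; false; _∧_; _∨_; not; T; if_then_else_)
import Data.Bool as Bool
open import Data.Bool.Properties using (∧-assoc; ∧-comm; ∨-comm; T-irrelevant; T-∧; T-∨)
open import Data.Empty using (⊥-elim)
open import Data.Fin using (Fin; zero; suc; _≟_; toℕ; combine; remQuot; punchOut)
open import Data.Fin.Permutation using (Permutation′; _⟨$⟩ʳ_; _⟨$⟩ˡ_; inverseˡ; inverseʳ; _∘ₚ_; transpose; ↔⇒≡) renaming (id to idₚ)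
open import Data.Fin.Properties using (0↔⊥; 1↔⊤; +↔⊎; *↔×; injective⇒≤; any?; all?; punchOut-injective; remQuot-combine; combine-remQuot; toℕ-injective; toℕ-fromℕ<; toℕ<n) renaming (suc-injective to Fin-suc-injective)
open import Data.Fin.Subset using (Subset; ∣_∣)
open import Data.List using (List; []; _∷_; _++_; length; map; foldr; applyUpTo)
open import Data.List.Properties using (length-map; length-++-comm; length-applyUpTo)
open import Data.List.Relation.Unary.All using (All; []; _∷_)
open import Data.Nat using (ℕ; zero; suc; _+_; _*_; _≤_; _<_; z≤n; s≤s; _≡ᵇ_; _%_)
import Data.Nat as ℕ
open import Data.Nat.DivMod using (_mod_; m<n⇒m%n≡m; n%n≡0; m%n<n)
open import Data.Nat.Properties hiding (_≟_)
open import Data.Nat.Tactic.RingSolver using (solve-∀)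
open import Data.Product using (Σ; _×_; _,_; proj₁; proj₂; ∃)
open import Data.Product.Function.NonDependent.Propositional using (_×-↔_)
open import Data.Sum using (_⊎_; inj₁; inj₂)
open import Data.Sum.Function.Propositional using (_⊎-↔_)
open import Data.Unit using (tt)
open import Data.Vec using (Vec; []; _∷_; lookup; tabulate)
open import Data.Vec.Properties using (lookup∘tabulate; tabulate∘lookup; tabulate-cong)
open import Function using (_∘_)
open import Function.Bundles using (_↔_; mk↔ₛ′; Inverse; Equivalence)
open import Function.Properties.Inverse using (↔-trans; ↔-sym; ↔-refl)
open import Relation.Binary.PropositionalEquality
open import Relation.Nullary using (¬_; Dec; does; yes; no; contradiction)
open import Relation.Nullary.Decidable using (dec-true; dec-false; toWitness; _×-dec_; _→-dec_; ¬?)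

open import Algebra.Properties.Semiring.Sum +-*-semiring using (sum; sum-cong-≗; ∑-distrib-+; ∑-comm; *-distribˡ-sum; *-distribʳ-sum)
open Inverse using (to; from; strictlyInverseˡ; strictlyInverseʳ)

-- Indicator functions and sums over finite sets.

ind : Bool → ℕ
ind true  = 1
ind false = 0

δ : ∀ {m} → Fin m → Fin m → ℕ
δ a b = ind (does (a ≟ b))

δ̄ : ∀ {m} → Fin m → Fin m → ℕ
δ̄ a b = ind (not (does (a ≟ b)))

δ-≡ : ∀ {m} {a b : Fin m} → a ≡ b → δ a b ≡ 1
δ-≡ {a = a} {b} p = cong ind (dec-true (a ≟ b) p)

δ-≢ : ∀ {m} {a b : Fin m} → a ≢ b → δ a b ≡ 0
δ-≢ {a = a} {b} p = cong ind (dec-false (a ≟ b) p)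

δ̄-≡ : ∀ {m} {a b : Fin m} → a ≡ b → δ̄ a b ≡ 0
δ̄-≡ {a = a} {b} p = cong (ind ∘ not) (dec-true (a ≟ b) p)

δ̄-≢ : ∀ {m} {a b : Fin m} → a ≢ b → δ̄ a b ≡ 1
δ̄-≢ {a = a} {b} p = cong (ind ∘ not) (dec-false (a ≟ b) p)

sum-mono-≤ : ∀ {m} {f g : Fin m → ℕ} → (∀ i → f i ≤ g i) → sum f ≤ sum g
sum-mono-≤ {zero}  f≤g = z≤n
sum-mono-≤ {suc m} f≤g = +-mono-≤ (f≤g zero) (sum-mono-≤ (f≤g ∘ suc))

sum-const : ∀ m c → sum {m} (λ _ → c) ≡ m * c
sum-const zero    c = refl
sum-const (suc m) c = cong (c +_) (sum-const m c)

sum-zero : ∀ {m} {f : Fin m → ℕ} → (∀ i → f i ≡ 0) → sum f ≡ 0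
sum-zero {m} f≡0 = trans (sum-cong-≗ f≡0) (trans (sum-const m 0) (*-zeroʳ m))

sum-δ : ∀ {m} (a : Fin m) (g : Fin m → ℕ) → sum (λ c → δ a c * g c) ≡ g a
sum-δ {suc m} zero    g = trans (cong₂ _+_ (+-identityʳ (g zero)) (sum-zero {m} (λ _ → refl))) (+-identityʳ (g zero))
sum-δ {suc m} (suc a) g = sum-δ a (g ∘ suc)

sum-δ-1 : ∀ {m} (a : Fin m) → sum (δ a) ≡ 1
sum-δ-1 a = trans (sum-cong-≗ (λ c → sym (*-identityʳ (δ a c)))) (sum-δ a (λ _ → 1))

δ-sym : ∀ {m} (a b : Fin m) → δ a b ≡ δ b a
δ-sym a b with a ≟ b
... | yes p = sym (δ-≡ (sym p))
... | no ¬p = sym (δ-≢ (¬p ∘ sym))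

sum-δ̄ : ∀ {s} (x : Fin (suc s)) → sum (λ c → δ̄ c x) ≡ s
sum-δ̄ {s} x = +-cancelʳ-≡ 1 _ _ (begin
  sum (λ c → δ̄ c x) + 1                ≡⟨ cong (sum (λ c → δ̄ c x) +_) (sym (sum-δ-1 x)) ⟩
  sum (λ c → δ̄ c x) + sum (δ x)        ≡⟨ sym (∑-distrib-+ (λ c → δ̄ c x) (δ x)) ⟩
  sum (λ c → δ̄ c x + δ x c)            ≡⟨ sum-cong-≗ (λ c → trans (cong (δ̄ c x +_) (δ-sym x c)) (comp c)) ⟩
  sum {suc s} (λ _ → 1)                ≡⟨ sum-const (suc s) 1 ⟩
  suc s * 1                            ≡⟨ *-identityʳ (suc s) ⟩
  suc s                                ≡⟨ +-comm 1 s ⟩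
  s + 1                                ∎)
  where
  open ≡-Reasoning
  comp : ∀ c → δ̄ c x + δ c x ≡ 1
  comp c with does (c ≟ x)
  ... | true  = refl
  ... | false = refl

perm-injective : ∀ {m} (π : Permutation′ m) {a b} → π ⟨$⟩ʳ a ≡ π ⟨$⟩ʳ b → a ≡ b
perm-injective π eq = trans (sym (inverseˡ π)) (trans (cong (π ⟨$⟩ˡ_) eq) (inverseˡ π))

δ-perm : ∀ {m} (π : Permutation′ m) a b → δ (π ⟨$⟩ʳ a) b ≡ δ (π ⟨$⟩ˡ b) a
δ-perm π a b with π ⟨$⟩ˡ b ≟ a
... | yes p = δ-≡ (trans (cong (π ⟨$⟩ʳ_) (sym p)) (inverseʳ π))
... | no ¬p = δ-≢ (λ q → ¬p (trans (cong (π ⟨$⟩ˡ_) (sym q)) (inverseˡ π)))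

sum-δ-perm : ∀ {m} (π : Permutation′ m) b → sum (λ c → δ (π ⟨$⟩ʳ c) b) ≡ 1
sum-δ-perm π b = trans (sum-cong-≗ (λ c → δ-perm π c b)) (sum-δ-1 (π ⟨$⟩ˡ b))

-- Walks around the rim that avoid the hub colour, and their transfer matrices.

allowed : ∀ {m} → Fin m → Permutation′ m → Fin m → Fin m → Bool
allowed x σ a b = not (does (a ≟ x)) ∧ not (does (b ≟ x)) ∧ not (does (σ ⟨$⟩ʳ a ≟ b))

-- An entry of the product of the transfer matrices. The empty product is the full identity, also at
-- `x`, so the entry at `(x , x)` vanishes only for nonempty lists.
walks : ∀ {m} → Fin m → List (Permutation′ m) → Fin m → Fin m → ℕ
walks x []       a b = δ a b
walks x (σ ∷ σs) a b = sum (λ c → ind (allowed x σ a c) * walks x σs c b)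

-- `_∘ₚ_` applies its left argument first, so the composite follows the rim in walking order.
composite : ∀ {m} → List (Permutation′ m) → Permutation′ m
composite = foldr _∘ₚ_ idₚ

Fixes : ∀ {m} → Fin m → Permutation′ m → Set
Fixes x σ = σ ⟨$⟩ʳ x ≡ x

composite-fixes : ∀ {m} {x : Fin m} {σs} → All (Fixes x) σs → Fixes x (composite σs)
composite-fixes []                           = refl
composite-fixes {σs = σ ∷ σs} (p ∷ ps) = trans (cong (composite σs ⟨$⟩ʳ_) p) (composite-fixes ps)

allowed-from-x : ∀ {m} (x : Fin m) σ b → allowed x σ x b ≡ false
allowed-from-x x σ b rewrite dec-true (x ≟ x) refl = refl

allowed-to-x : ∀ {m} (x : Fin m) σ a → allowed x σ a x ≡ false
allowed-to-x x σ a rewrite dec-true (x ≟ x) refl with does (a ≟ x)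
... | true  = refl
... | false = refl

allowed-≢ : ∀ {m} {x : Fin m} {σ a b} → a ≢ x → b ≢ x → allowed x σ a b ≡ not (does (σ ⟨$⟩ʳ a ≟ b))
allowed-≢ {x = x} {a = a} {b} p q rewrite dec-false (a ≟ x) p | dec-false (b ≟ x) q = refl

walks-from-x : ∀ {m} (x : Fin m) σs b → b ≢ x → walks x σs x b ≡ 0
walks-from-x x []       b b≢x = δ-≢ (b≢x ∘ sym)
walks-from-x x (σ ∷ σs) b b≢x = sum-zero (λ c → cong (λ t → ind t * walks x σs c b) (allowed-from-x x σ c))

walks-xx : ∀ {m} (x : Fin m) σ σs → walks x (σ ∷ σs) x x ≡ 0
walks-xx x σ σs = sum-zero (λ c → cong (λ t → ind t * walks x σs c x) (allowed-from-x x σ c))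

-- The transfer matrix of a rim edge is J − P on the colours other than x.
walks-∷ : ∀ {m} (x : Fin m) σ σs a b → a ≢ x → b ≢ x →
  walks x (σ ∷ σs) a b + walks x σs (σ ⟨$⟩ʳ a) b ≡ sum (λ c → walks x σs c b)
walks-∷ x σ σs a b a≢x b≢x = begin
  walks x (σ ∷ σs) a b + w (σ ⟨$⟩ʳ a)  ≡⟨ cong (walks x (σ ∷ σs) a b +_) (sym (sum-δ (σ ⟨$⟩ʳ a) w)) ⟩
  sum f + sum g                        ≡⟨ sym (∑-distrib-+ f g) ⟩
  sum (λ c → f c + g c)                ≡⟨ sum-cong-≗ split ⟩
  sum w                                ∎
  where
  open ≡-Reasoning
  w f g : _ → ℕ
  w c = walks x σs c b
  f c = ind (allowed x σ a c) * w c
  g c = δ (σ ⟨$⟩ʳ a) c * w c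
  split′ : ∀ c → Dec (c ≡ x) → f c + g c ≡ w c
  split′ c (yes refl) = trans (cong (λ u → ind (allowed x σ a x) * u + δ (σ ⟨$⟩ʳ a) x * u) w0)
    (trans (cong₂ _+_ (*-zeroʳ (ind (allowed x σ a x))) (*-zeroʳ (δ (σ ⟨$⟩ʳ a) x))) (sym w0))
    where w0 = walks-from-x x σs b b≢x
  split′ c (no c≢x) rewrite allowed-≢ {σ = σ} a≢x c≢x with does (σ ⟨$⟩ʳ a ≟ c)
  ... | true  = +-identityʳ (w c)
  ... | false = trans (+-identityʳ _) (+-identityʳ (w c))
  split : ∀ c → f c + g c ≡ w c
  split c = split′ c (c ≟ x)

double : ℕ → ℕ
double zero    = zero
double (suc j) = suc (suc (double j))

module _ (r′ : ℕ) where

  private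
    r s m : ℕ
    r = suc r′
    s = suc r
    m = suc s

  -- The number of walks of length 2j, respectively 2j + 1, between two vertices
  -- that are not matched by the composite permutation.
  evenCoeff oddCoeff : ℕ → ℕ
  evenCoeff zero    = 0
  evenCoeff (suc j) = r′ + r * (r * evenCoeff j)
  oddCoeff j = suc (r * evenCoeff j)

  -- The recursion for `evenCoeff` is `r * oddCoeff j − 1`, expanded with `r = r′ + 1` so that no
  -- subtraction occurs; this restores the compact form.
  r*oddCoeff : ∀ j → r * oddCoeff j ≡ suc (evenCoeff (suc j))
  r*oddCoeff j = *-suc r (r * evenCoeff j)

  module _ {x b : Fin m} (b≢x : b ≢ x) where

    private
      δ-fix : ∀ {τs} → All (Fixes x) τs → δ (composite τs ⟨$⟩ʳ x) b ≡ 0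
      δ-fix fix = δ-≢ (λ p → b≢x (trans (sym p) (composite-fixes fix)))

      image-≢ : ∀ {τ a} → Fixes x τ → a ≢ x → τ ⟨$⟩ʳ a ≢ x
      image-≢ {τ} fx a≢x p = a≢x (perm-injective τ (trans p (sym fx)))

    -- Mutual induction on the length. On the `s = r + 1` colours other than `x`, left
    -- multiplication by `J − P` sends `cJ + Q` to `(rc + 1)J − PQ`, and `cJ − Q` to
    -- `(rc − 1)J + PQ`. The negative permutation matrix of the odd case is moved to the left-hand
    -- side to stay in `ℕ`, and the factor `δ̄ a x` extends both formulas to the zero row `x`.
    walks-even : ∀ j τs → length τs ≡ double j → All (Fixes x) τs → ∀ a →
      walks x τs a b ≡ δ̄ a x * evenCoeff j + δ (composite τs ⟨$⟩ʳ a) b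
    walks-odd : ∀ j τs → length τs ≡ suc (double j) → All (Fixes x) τs → ∀ a →
      walks x τs a b + δ (composite τs ⟨$⟩ʳ a) b ≡ δ̄ a x * oddCoeff j

    walks-even zero [] refl [] a = cong (_+ δ a b) (sym (*-zeroʳ (δ̄ a x)))
    walks-even (suc j) (τ ∷ τs) len (fx ∷ fxs) a = by-cases (a ≟ x)
      where
      open ≡-Reasoning
      w : Fin m → ℕ
      w c = walks x τs c b
      O = oddCoeff j
      G = evenCoeff (suc j)
      W = walks x (τ ∷ τs) a b
      V = w (τ ⟨$⟩ʳ a)
      d = δ (composite (τ ∷ τs) ⟨$⟩ʳ a) b
      lem₁ : ∀ p q → p + suc q ≡ suc (p + q)
      lem₁ = solve-∀
      lem₂ : ∀ p q e → suc (p + (q + e)) ≡ p + q + 1 + e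
      lem₂ = solve-∀
      lem₃ : ∀ p q e → p + suc q + e ≡ 1 * q + e + suc p
      lem₃ = solve-∀
      IH = walks-odd j τs (suc-injective len) fxs
      ih : a ≢ x → V + d ≡ O
      ih a≢x = trans (IH (τ ⟨$⟩ʳ a)) (trans (cong (_* O) (δ̄-≢ (image-≢ {τ} fx a≢x))) (+-identityʳ O))
      -- The column sum of `O J − Q`: a column of `J` has `s` ones, a column of `Q` has one.
      col : sum w + 1 ≡ s * O
      col = begin
        sum w + 1 ≡⟨ cong (sum w +_) (sym (sum-δ-perm (composite τs) b)) ⟩
        sum w + sum (λ c → δ (composite τs ⟨$⟩ʳ c) b) ≡⟨ sym (∑-distrib-+ w (λ c → δ (composite τs ⟨$⟩ʳ c) b)) ⟩
        sum (λ c → w c + δ (composite τs ⟨$⟩ʳ c) b)   ≡⟨ sum-cong-≗ IH ⟩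
        sum (λ c → δ̄ c x * O)                         ≡⟨ sym (*-distribʳ-sum O (λ c → δ̄ c x)) ⟩
        sum (λ c → δ̄ c x) * O                         ≡⟨ cong (_* O) (sum-δ̄ {s} x) ⟩
        s * O ∎
      by-cases : Dec (a ≡ x) → W ≡ δ̄ a x * G + d
      by-cases (yes refl) = trans (walks-from-x x (τ ∷ τs) b b≢x)
        (sym (cong₂ (λ u v → u * G + v) (δ̄-≡ {a = x} refl) (δ-fix {τ ∷ τs} (fx ∷ fxs))))
      -- Adding `suc O` to both sides turns `W = sum w − V`, `V = O − d` and `sum w = s * O − 1`
      -- into identities without subtraction.
      by-cases (no a≢x) = +-cancelʳ-≡ (suc O) _ _ (begin
        W + suc O                     ≡⟨ lem₁ W O ⟩
        suc (W + O)                   ≡⟨ cong (λ t → suc (W + t)) (sym (ih a≢x)) ⟩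
        suc (W + (V + d))             ≡⟨ lem₂ W V d ⟩
        W + V + 1 + d                 ≡⟨ cong (λ t → t + 1 + d) (walks-∷ x τ τs a b a≢x b≢x) ⟩
        sum w + 1 + d                 ≡⟨ cong (_+ d) col ⟩
        s * O + d                     ≡⟨ cong (λ t → O + t + d) (r*oddCoeff j) ⟩
        O + suc G + d                 ≡⟨ lem₃ O G d ⟩
        1 * G + d + suc O             ≡⟨ cong (λ t → t * G + d + suc O) (sym (δ̄-≢ a≢x)) ⟩
        δ̄ a x * G + d + suc O         ∎)

    walks-odd j (τ ∷ τs) len (fx ∷ fxs) a = by-cases (a ≟ x)
      where
      open ≡-Reasoning
      w : Fin m → ℕ
      w c = walks x τs c b
      G = evenCoeff j
      W = walks x (τ ∷ τs) a b
      V = w (τ ⟨$⟩ʳ a)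
      d = δ (composite (τ ∷ τs) ⟨$⟩ʳ a) b
      lem₁ : ∀ p e q → p + e + q ≡ p + (1 * q + e)
      lem₁ = solve-∀
      lem₂ : ∀ p q → p + q + 1 ≡ 1 * suc q + p
      lem₂ = solve-∀
      IH = walks-even j τs (suc-injective len) fxs
      ih : a ≢ x → V ≡ 1 * G + d
      ih a≢x = trans (IH (τ ⟨$⟩ʳ a)) (cong (λ t → t * G + d) (δ̄-≢ (image-≢ {τ} fx a≢x)))
      col : sum w ≡ s * G + 1
      col = begin
        sum w ≡⟨ sum-cong-≗ IH ⟩
        sum (λ c → δ̄ c x * G + δ (composite τs ⟨$⟩ʳ c) b) ≡⟨ ∑-distrib-+ (λ c → δ̄ c x * G) (λ c → δ (composite τs ⟨$⟩ʳ c) b) ⟩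
        sum (λ c → δ̄ c x * G) + sum (λ c → δ (composite τs ⟨$⟩ʳ c) b)
          ≡⟨ cong₂ _+_ (trans (sym (*-distribʳ-sum G (λ c → δ̄ c x))) (cong (_* G) (sum-δ̄ {s} x))) (sum-δ-perm (composite τs) b) ⟩
        s * G + 1 ∎
      by-cases : Dec (a ≡ x) → W + d ≡ δ̄ a x * oddCoeff j
      by-cases (yes refl) = trans (cong₂ _+_ (walks-from-x x (τ ∷ τs) b b≢x) (δ-fix {τ ∷ τs} (fx ∷ fxs)))
        (cong (_* oddCoeff j) (sym (δ̄-≡ {a = x} refl)))
      by-cases (no a≢x) = +-cancelʳ-≡ G _ _ (begin
        W + d + G                     ≡⟨ lem₁ W d G ⟩
        W + (1 * G + d)               ≡⟨ cong (W +_) (sym (ih a≢x)) ⟩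
        W + V                         ≡⟨ walks-∷ x τ τs a b a≢x b≢x ⟩
        sum w                         ≡⟨ col ⟩
        s * G + 1                     ≡⟨ lem₂ G (r * G) ⟩
        1 * oddCoeff j + G            ≡⟨ cong (λ t → t * oddCoeff j + G) (sym (δ̄-≢ a≢x)) ⟩
        δ̄ a x * oddCoeff j + G        ∎)

-- Redirecting a permutation so that it fixes the hub colour.

transpose-left : ∀ {m} (i j : Fin m) → transpose i j ⟨$⟩ʳ i ≡ j
transpose-left i j rewrite dec-true (i ≟ i) refl = refl

transpose-right : ∀ {m} (i j : Fin m) → transpose i j ⟨$⟩ʳ j ≡ i
transpose-right i j with j ≟ i
... | yes p = p
... | no _ rewrite dec-true (j ≟ j) refl = refl

transpose-other : ∀ {m} {i j k : Fin m} → k ≢ i → k ≢ j → transpose i j ⟨$⟩ʳ k ≡ k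
transpose-other {i = i} {j} {k} p q rewrite dec-false (k ≟ i) p | dec-false (k ≟ j) q = refl

-- The permutation of the colours other than x that agrees with σ wherever σ
-- avoids x, and sends σ⁻¹ x to σ x.
bypass : ∀ {m} → Fin m → Permutation′ m → Permutation′ m
bypass x σ = σ ∘ₚ transpose x (σ ⟨$⟩ʳ x)

bypass-fixes : ∀ {m} (x : Fin m) σ → Fixes x (bypass x σ)
bypass-fixes x σ = transpose-right x (σ ⟨$⟩ʳ x)

bypass-agrees : ∀ {m} {x : Fin m} σ {a} → a ≢ x → σ ⟨$⟩ʳ a ≢ x → bypass x σ ⟨$⟩ʳ a ≡ σ ⟨$⟩ʳ a
bypass-agrees σ a≢x σa≢x = transpose-other σa≢x (a≢x ∘ perm-injective σ)

bypass-preimage : ∀ {m} {x : Fin m} σ {p} → σ ⟨$⟩ʳ p ≡ x → bypass x σ ⟨$⟩ʳ p ≡ σ ⟨$⟩ʳ x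
bypass-preimage {x = x} σ σp≡x = trans (cong (transpose x (σ ⟨$⟩ʳ x) ⟨$⟩ʳ_) σp≡x) (transpose-left x _)

all-bypass-fixes : ∀ {m} (x : Fin m) σs → All (Fixes x) (map (bypass x) σs)
all-bypass-fixes x []       = []
all-bypass-fixes x (σ ∷ σs) = bypass-fixes x σ ∷ all-bypass-fixes x σs

bypass-fixed : ∀ {m} {x a : Fin m} → a ≢ x → ∀ {σs} → All (Fixes a) σs → All (Fixes a) (map (bypass x) σs)
bypass-fixed a≢x []       = []
bypass-fixed {x = x} {a} a≢x {σ ∷ σs} (p ∷ ps) =
  trans (bypass-agrees σ a≢x (λ q → a≢x (trans (sym p) q))) p ∷ bypass-fixed a≢x ps

ind-≤1 : ∀ b → ind b ≤ 1
ind-≤1 true  = ≤-refl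
ind-≤1 false = z≤n

-- A pair avoiding `x` that is matched by `σ` is still matched by the bypass, so the bypass forbids
-- at least as much.
allowed-bypass : ∀ {m} (x : Fin m) σ a b → ind (allowed x (bypass x σ) a b) ≤ ind (allowed x σ a b)
allowed-bypass x σ a b with a ≟ x | b ≟ x
... | yes _  | _      = z≤n
... | no _   | yes _  = z≤n
... | no a≢x | no b≢x with σ ⟨$⟩ʳ a ≟ b
...   | no _  = ind-≤1 _
...   | yes p = ≤-reflexive (cong (ind ∘ not) (dec-true (_ ≟ b)
                  (trans (bypass-agrees σ a≢x (λ q → b≢x (trans (sym p) q))) p)))

walks-bypass : ∀ {m} (x : Fin m) σs a b → walks x (map (bypass x) σs) a b ≤ walks x σs a b
walks-bypass x []       a b = ≤-refl
walks-bypass x (σ ∷ σs) a b = sum-mono-≤ (λ c → *-mono-≤ (allowed-bypass x σ a c) (walks-bypass x σs c b))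

-- Closed walks as traces, rotation of the rim, and colours fixed along it.

trace : ∀ {m} → Fin m → List (Permutation′ m) → ℕ
trace x σs = sum (λ a → walks x σs a a)

total : ∀ {m} → List (Permutation′ m) → ℕ
total σs = sum (λ x → trace x σs)

trace-bypass : ∀ {m} (x : Fin m) σs → trace x (map (bypass x) σs) ≤ trace x σs
trace-bypass x σs = sum-mono-≤ (λ a → walks-bypass x σs a a)

walks-++ : ∀ {m} (x : Fin m) σs ρs a b →
  walks x (σs ++ ρs) a b ≡ sum (λ c → walks x σs a c * walks x ρs c b)
walks-++ x []       ρs a b = sym (sum-δ a (λ c → walks x ρs c b))
walks-++ x (σ ∷ σs) ρs a b = begin
  sum (λ d → i d * walks x (σs ++ ρs) d b)                       ≡⟨ sum-cong-≗ (λ d → cong (i d *_) (walks-++ x σs ρs d b)) ⟩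
  sum (λ d → i d * sum (λ c → walks x σs d c * walks x ρs c b))  ≡⟨ sum-cong-≗ (λ d → *-distribˡ-sum (i d) (λ c → walks x σs d c * walks x ρs c b)) ⟩
  sum (λ d → sum (λ c → i d * (walks x σs d c * walks x ρs c b))) ≡⟨ ∑-comm (λ d c → i d * (walks x σs d c * walks x ρs c b)) ⟩
  sum (λ c → sum (λ d → i d * (walks x σs d c * walks x ρs c b))) ≡⟨ sum-cong-≗ (λ c → sum-cong-≗ (λ d → sym (*-assoc (i d) (walks x σs d c) (walks x ρs c b)))) ⟩
  sum (λ c → sum (λ d → i d * walks x σs d c * walks x ρs c b))  ≡⟨ sum-cong-≗ (λ c → sym (*-distribʳ-sum (walks x ρs c b) (λ d → i d * walks x σs d c))) ⟩
  sum (λ c → walks x (σ ∷ σs) a c * walks x ρs c b)              ∎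
  where
  open ≡-Reasoning
  i : _ → ℕ
  i d = ind (allowed x σ a d)

-- The identity tr(AB) = tr(BA). It rotates the rim so that any chosen edge comes first.
trace-++-comm : ∀ {m} (x : Fin m) σs ρs → trace x (σs ++ ρs) ≡ trace x (ρs ++ σs)
trace-++-comm x σs ρs = begin
  sum (λ a → walks x (σs ++ ρs) a a)                         ≡⟨ sum-cong-≗ (λ a → walks-++ x σs ρs a a) ⟩
  sum (λ a → sum (λ c → walks x σs a c * walks x ρs c a))    ≡⟨ ∑-comm (λ a c → walks x σs a c * walks x ρs c a) ⟩
  sum (λ c → sum (λ a → walks x σs a c * walks x ρs c a))    ≡⟨ sum-cong-≗ (λ c → sum-cong-≗ (λ a → *-comm (walks x σs a c) (walks x ρs c a))) ⟩
  sum (λ c → sum (λ a → walks x ρs c a * walks x σs a c))    ≡⟨ sum-cong-≗ (λ c → sym (walks-++ x ρs σs c c)) ⟩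
  sum (λ c → walks x (ρs ++ σs) c c)                         ∎
  where open ≡-Reasoning

fixedByAll : ∀ {m} → Fin m → List (Permutation′ m) → Bool
fixedByAll a []       = true
fixedByAll a (σ ∷ σs) = does (σ ⟨$⟩ʳ a ≟ a) ∧ fixedByAll a σs

fixedByAll-++ : ∀ {m} (a : Fin m) σs ρs → fixedByAll a (σs ++ ρs) ≡ fixedByAll a σs ∧ fixedByAll a ρs
fixedByAll-++ a []       ρs = refl
fixedByAll-++ a (σ ∷ σs) ρs = trans (cong (does (σ ⟨$⟩ʳ a ≟ a) ∧_) (fixedByAll-++ a σs ρs))
  (sym (∧-assoc (does (σ ⟨$⟩ʳ a ≟ a)) _ _))

fixedByAll-++-comm : ∀ {m} (a : Fin m) σs ρs → fixedByAll a (σs ++ ρs) ≡ fixedByAll a (ρs ++ σs)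
fixedByAll-++-comm a σs ρs = trans (fixedByAll-++ a σs ρs)
  (trans (∧-comm (fixedByAll a σs) _) (sym (fixedByAll-++ a ρs σs)))

fixedByAll-sound : ∀ {m} (a : Fin m) σs → fixedByAll a σs ≡ true → All (Fixes a) σs
fixedByAll-sound a []       _  = []
fixedByAll-sound a (σ ∷ σs) eq with σ ⟨$⟩ʳ a ≟ a
... | yes p = p ∷ fixedByAll-sound a σs eq
fixedByAll-sound a (σ ∷ σs) () | no _

moved-split : ∀ {m} (a : Fin m) σs → fixedByAll a σs ≡ false →
  ∃ λ pre → ∃ λ σ → ∃ λ post → σs ≡ pre ++ σ ∷ post × σ ⟨$⟩ʳ a ≢ a
moved-split a (σ ∷ σs) eq with σ ⟨$⟩ʳ a ≟ a
... | no p = [] , σ , σs , refl , p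
... | yes _ with moved-split a σs eq
...   | pre , ρ , post , eq′ , p = σ ∷ pre , ρ , post , cong (σ ∷_) eq′ , p

#fixed : ∀ {m} → List (Permutation′ m) → ℕ
#fixed σs = sum (λ a → ind (fixedByAll a σs))

-- The trace of the permutation matrix on the colours other than `x`.
fixedPoints : ∀ {m} → Fin m → Permutation′ m → ℕ
fixedPoints x π = sum (λ a → δ̄ a x * δ (π ⟨$⟩ʳ a) a)

-- Besides the walks of the bypassed cover, one may traverse the pair (σ⁻¹ x , σ x)
-- that is matched by the bypass but not by σ.
trace-moved : ∀ {m} (x : Fin m) σ σs → σ ⟨$⟩ʳ x ≢ x →
  trace x (map (bypass x) (σ ∷ σs)) + walks x (map (bypass x) σs) (σ ⟨$⟩ʳ x) (σ ⟨$⟩ˡ x) ≤ trace x (σ ∷ σs)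
trace-moved x σ σs q≢x = begin
  trace x (τ ∷ τs) + w q p                                     ≡⟨ cong (trace x (τ ∷ τs) +_) (sym (sum-δ p (w q))) ⟩
  trace x (τ ∷ τs) + sum (λ a → δ p a * w q a)                 ≡⟨ sym (∑-distrib-+ (λ a → walks x (τ ∷ τs) a a) (λ a → δ p a * w q a)) ⟩
  sum (λ a → walks x (τ ∷ τs) a a + δ p a * w q a)             ≤⟨ sum-mono-≤ (λ a → at a (p ≟ a)) ⟩
  trace x (σ ∷ σs)                                             ∎
  where
  open ≤-Reasoning
  p = σ ⟨$⟩ˡ x
  q = σ ⟨$⟩ʳ x
  τ = bypass x σ
  τs = map (bypass x) σs
  w = walks x τs
  p≢x : p ≢ x
  p≢x eq = q≢x (trans (cong (σ ⟨$⟩ʳ_) (sym eq)) (inverseʳ σ))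
  extra : ∀ c → Dec (c ≡ x) → ind (allowed x τ p c) + δ q c ≤ ind (allowed x σ p c)
  extra c (yes refl) rewrite allowed-to-x x τ p | δ-≢ q≢x = z≤n
  extra c (no c≢x) rewrite allowed-≢ {σ = τ} p≢x c≢x | allowed-≢ {σ = σ} p≢x c≢x
    | bypass-preimage σ {p} (inverseʳ σ) | inverseʳ σ {x} | dec-false (x ≟ c) (c≢x ∘ sym) with does (q ≟ c)
  ... | true  = ≤-refl
  ... | false = ≤-refl
  at : ∀ a → Dec (p ≡ a) → walks x (τ ∷ τs) a a + δ p a * w q a ≤ walks x (σ ∷ σs) a a
  at a (no p≢a) rewrite δ-≢ p≢a | +-identityʳ (walks x (τ ∷ τs) a a) = walks-bypass x (σ ∷ σs) a a
  at a (yes refl) = begin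
    walks x (τ ∷ τs) p p + δ p p * w q p    ≡⟨ cong (λ t → walks x (τ ∷ τs) p p + t * w q p) (δ-≡ {a = p} refl) ⟩
    walks x (τ ∷ τs) p p + 1 * w q p        ≡⟨ cong (walks x (τ ∷ τs) p p +_) (trans (*-identityˡ (w q p)) (sym (sum-δ q (λ c → w c p)))) ⟩
    sum (λ c → i c * w c p) + sum (λ c → δ q c * w c p)
                                            ≡⟨ sym (∑-distrib-+ (λ c → i c * w c p) (λ c → δ q c * w c p)) ⟩
    sum (λ c → i c * w c p + δ q c * w c p) ≡⟨ sum-cong-≗ (λ c → sym (*-distribʳ-+ (w c p) (i c) (δ q c))) ⟩
    sum (λ c → (i c + δ q c) * w c p)       ≤⟨ sum-mono-≤ (λ c → *-mono-≤ (extra c (c ≟ x)) (walks-bypass x σs c p)) ⟩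
    walks x (σ ∷ σs) p p                    ∎
    where
    i : _ → ℕ
    i c = ind (allowed x τ p c)

-- Lower bounds for closed walks, and their exact number when all matchings are the identity.

module _ (r′ : ℕ) where

  private
    r s m : ℕ
    r = suc r′
    s = suc r
    m = suc s

  -- Sums the diagonal of `walks-even`. The length starts at 2 because the diagonal entry at `x` is
  -- 0 only for nonempty walks.
  trace-even : ∀ (x : Fin m) j τs → length τs ≡ double (suc j) → All (Fixes x) τs →
    trace x τs ≡ s * evenCoeff r′ (suc j) + fixedPoints x (composite τs)
  trace-even x j τs@(τ ∷ ρs) len fix = begin
    sum (λ a → walks x τs a a)                  ≡⟨ sum-cong-≗ (λ a → at a (a ≟ x)) ⟩
    sum (λ a → δ̄ a x * G + δ̄ a x * d a)         ≡⟨ ∑-distrib-+ (λ a → δ̄ a x * G) (λ a → δ̄ a x * d a) ⟩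
    sum (λ a → δ̄ a x * G) + sum (λ a → δ̄ a x * d a)
      ≡⟨ cong (_+ sum (λ a → δ̄ a x * d a)) (trans (sym (*-distribʳ-sum G (λ a → δ̄ a x))) (cong (_* G) (sum-δ̄ {s} x))) ⟩
    s * G + fixedPoints x (composite τs)        ∎
    where
    open ≡-Reasoning
    G = evenCoeff r′ (suc j)
    d : Fin m → ℕ
    d a = δ (composite τs ⟨$⟩ʳ a) a
    at : ∀ a → Dec (a ≡ x) → walks x τs a a ≡ δ̄ a x * G + δ̄ a x * d a
    at a (yes refl) = trans (walks-xx x τ ρs) (cong (λ t → t * G + t * d x) (sym (δ̄-≡ {a = x} refl)))
    at a (no a≢x) = trans (walks-even r′ a≢x (suc j) τs len fix a)
      (cong (δ̄ a x * G +_) (sym (trans (cong (_* d a) (δ̄-≢ a≢x)) (*-identityˡ (d a)))))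

  trace-odd : ∀ (x : Fin m) j τs → length τs ≡ suc (double j) → All (Fixes x) τs →
    trace x τs + fixedPoints x (composite τs) ≡ s * oddCoeff r′ j
  trace-odd x j τs@(τ ∷ ρs) len fix = begin
    sum (λ a → walks x τs a a) + fixedPoints x (composite τs) ≡⟨ sym (∑-distrib-+ (λ a → walks x τs a a) (λ a → δ̄ a x * d a)) ⟩
    sum (λ a → walks x τs a a + δ̄ a x * d a)     ≡⟨ sum-cong-≗ (λ a → at a (a ≟ x)) ⟩
    sum (λ a → δ̄ a x * O)                        ≡⟨ sym (*-distribʳ-sum O (λ a → δ̄ a x)) ⟩
    sum (λ a → δ̄ a x) * O                        ≡⟨ cong (_* O) (sum-δ̄ {s} x) ⟩
    s * O                                        ∎
    where
    open ≡-Reasoning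
    O = oddCoeff r′ j
    d : Fin m → ℕ
    d a = δ (composite τs ⟨$⟩ʳ a) a
    at : ∀ a → Dec (a ≡ x) → walks x τs a a + δ̄ a x * d a ≡ δ̄ a x * O
    at a (yes refl) = trans (cong₂ (λ u v → u + v * d x) (walks-xx x τ ρs) (δ̄-≡ {a = x} refl))
      (cong (_* O) (sym (δ̄-≡ {a = x} refl)))
    at a (no a≢x) = trans (cong (walks x τs a a +_) (trans (cong (_* d a) (δ̄-≢ a≢x)) (*-identityˡ (d a))))
      (walks-odd r′ a≢x j τs len fix a)

  fixedPoints-≤ : ∀ (x : Fin m) π → fixedPoints x π ≤ s
  fixedPoints-≤ x π = subst (fixedPoints x π ≤_) (sum-δ̄ {s} x)
    (sum-mono-≤ (λ a → ≤-trans (*-monoʳ-≤ (δ̄ a x) (ind-≤1 (does (π ⟨$⟩ʳ a ≟ a)))) (≤-reflexive (*-identityʳ (δ̄ a x)))))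

  fixedPoints-id : ∀ (x : Fin m) π → (∀ a → π ⟨$⟩ʳ a ≡ a) → fixedPoints x π ≡ s
  fixedPoints-id x π π-id = trans (sum-cong-≗ (λ a → trans (cong (δ̄ a x *_) (δ-≡ (π-id a))) (*-identityʳ (δ̄ a x))))
    (sum-δ̄ {s} x)

  trace-odd-≥ : ∀ (x : Fin m) j σs → length σs ≡ suc (double j) →
    s * oddCoeff r′ j ≤ trace x σs + s
  trace-odd-≥ x j σs len = begin
    s * oddCoeff r′ j                                    ≡⟨ sym (trace-odd x j τs (trans (length-map (bypass x) σs) len) (all-bypass-fixes x σs)) ⟩
    trace x τs + fixedPoints x (composite τs)            ≤⟨ +-mono-≤ (trace-bypass x σs) (fixedPoints-≤ x (composite τs)) ⟩
    trace x σs + s                                       ∎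
    where
    open ≤-Reasoning
    τs = map (bypass x) σs

  private
    fixed-composite : ∀ {x a : Fin m} σs → a ≢ x → fixedByAll a σs ≡ true →
      composite (map (bypass x) σs) ⟨$⟩ʳ a ≡ a
    fixed-composite {x} {a} σs a≢x eq = composite-fixes (bypass-fixed a≢x (fixedByAll-sound a σs eq))

  -- A colour other than `x` that every `σ` fixes is never redirected, so it stays a fixed point
  -- after the bypass. Only `x` itself may be lost, hence the 1.
  #fixed-≤ : ∀ (x : Fin m) σs → #fixed σs ≤ fixedPoints x (composite (map (bypass x) σs)) + 1
  #fixed-≤ x σs = begin
    #fixed σs                                  ≤⟨ sum-mono-≤ (λ a → at a (a ≟ x)) ⟩
    sum (λ a → g a + δ x a)                    ≡⟨ ∑-distrib-+ g (δ x) ⟩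
    sum g + sum (δ x)                          ≡⟨ cong (sum g +_) (sum-δ-1 x) ⟩
    sum g + 1                                  ∎
    where
    open ≤-Reasoning
    π = composite (map (bypass x) σs)
    g : Fin m → ℕ
    g a = δ̄ a x * δ (π ⟨$⟩ʳ a) a
    at : ∀ a → Dec (a ≡ x) → ind (fixedByAll a σs) ≤ g a + δ x a
    at a (yes refl) rewrite δ-≡ {a = x} {x} refl = ≤-trans (ind-≤1 _) (m≤n+m 1 _)
    at a (no a≢x) with fixedByAll a σs in eq
    ... | false = z≤n
    ... | true  = ≤-trans (≤-reflexive (sym (cong₂ _*_ (δ̄-≢ a≢x) (δ-≡ (fixed-composite σs a≢x eq))))) (m≤m+n _ _)

  trace-even-≥ : ∀ (x : Fin m) j σs → length σs ≡ double (suc j) →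
    s * evenCoeff r′ (suc j) + #fixed σs ≤ trace x σs + 1
  trace-even-≥ x j σs len = begin
    s * G + #fixed σs                                ≤⟨ +-monoʳ-≤ (s * G) (#fixed-≤ x σs) ⟩
    s * G + (fixedPoints x (composite τs) + 1)       ≡⟨ sym (+-assoc (s * G) _ 1) ⟩
    s * G + fixedPoints x (composite τs) + 1         ≡⟨ cong (_+ 1) (sym (trace-even x j τs (trans (length-map (bypass x) σs) len) (all-bypass-fixes x σs))) ⟩
    trace x τs + 1                                   ≤⟨ +-monoˡ-≤ 1 (trace-bypass x σs) ⟩
    trace x σs + 1                                   ∎
    where
    open ≤-Reasoning
    G = evenCoeff r′ (suc j)
    τs = map (bypass x) σs

  -- If the composite sends q back to p, then the deficit in the number of walks
  -- from q to p is made up for by the fixed point p, which no σ-fixed colour accounts for.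
  trace-even-moved-head : ∀ (x : Fin m) j σ σs → length (σ ∷ σs) ≡ double (suc j) → σ ⟨$⟩ʳ x ≢ x →
    s * evenCoeff r′ (suc j) + #fixed (σ ∷ σs) + oddCoeff r′ j ≤ trace x (σ ∷ σs)
  trace-even-moved-head x j σ σs len q≢x = begin
    s * G + F + O                                ≡⟨ cong (s * G + F +_) (sym walk-qp) ⟩
    s * G + F + (w + d)                          ≡⟨ lem (s * G) F w d ⟩
    s * G + (F + d) + w                          ≤⟨ +-monoˡ-≤ w (+-monoʳ-≤ (s * G) fixed) ⟩
    s * G + fixedPoints x (composite (τ ∷ τs)) + w
      ≡⟨ cong (_+ w) (sym (trace-even x j (τ ∷ τs) (cong suc len′) (all-bypass-fixes x (σ ∷ σs)))) ⟩
    trace x (τ ∷ τs) + w                         ≤⟨ trace-moved x σ σs q≢x ⟩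
    trace x (σ ∷ σs)                             ∎
    where
    open ≤-Reasoning
    p = σ ⟨$⟩ˡ x
    q = σ ⟨$⟩ʳ x
    τ = bypass x σ
    τs = map (bypass x) σs
    G = evenCoeff r′ (suc j)
    O = oddCoeff r′ j
    F = #fixed (σ ∷ σs)
    w = walks x τs q p
    d = δ (composite τs ⟨$⟩ʳ q) p
    lem : ∀ a b c e → a + b + (c + e) ≡ a + (b + e) + c
    lem = solve-∀
    len′ : length τs ≡ suc (double j)
    len′ = trans (length-map (bypass x) σs) (suc-injective len)
    p≢x : p ≢ x
    p≢x eq = q≢x (trans (cong (σ ⟨$⟩ʳ_) (sym eq)) (inverseʳ σ))
    walk-qp : w + d ≡ O
    walk-qp = trans (walks-odd r′ p≢x j τs len′ (all-bypass-fixes x σs) q)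
      (trans (cong (_* O) (δ̄-≢ q≢x)) (*-identityˡ O))
    g : Fin m → ℕ
    g a = δ̄ a x * δ (composite (τ ∷ τs) ⟨$⟩ʳ a) a
    at : ∀ a → Dec (p ≡ a) → ind (fixedByAll a (σ ∷ σs)) + δ p a * d ≤ g a
    at a (yes refl) rewrite dec-false (σ ⟨$⟩ʳ p ≟ p) (λ eq → p≢x (trans (sym eq) (inverseʳ σ)))
      | δ-≡ {a = p} {p} refl | δ̄-≢ p≢x | bypass-preimage σ {p} (inverseʳ σ) = ≤-refl
    at a (no p≢a) rewrite δ-≢ p≢a | +-identityʳ (ind (fixedByAll a (σ ∷ σs))) = fixed-at (fixedByAll a (σ ∷ σs)) refl
      where
      fixed-at : ∀ t → fixedByAll a (σ ∷ σs) ≡ t → ind t ≤ g a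
      fixed-at false _  = z≤n
      fixed-at true  eq = ≤-reflexive (sym (cong₂ _*_ (δ̄-≢ a≢x) (δ-≡ (fixed-composite (σ ∷ σs) a≢x eq))))
        where
        a≢x : a ≢ x
        a≢x refl with fixedByAll-sound a (σ ∷ σs) eq
        ... | σa≡a ∷ _ = q≢x σa≡a
    fixed : F + d ≤ fixedPoints x (composite (τ ∷ τs))
    fixed = begin
      F + d                                                          ≡⟨ cong (F +_) (sym (sum-δ p (λ _ → d))) ⟩
      F + sum (λ a → δ p a * d)                                      ≡⟨ sym (∑-distrib-+ (λ a → ind (fixedByAll a (σ ∷ σs))) (λ a → δ p a * d)) ⟩
      sum (λ a → ind (fixedByAll a (σ ∷ σs)) + δ p a * d)            ≤⟨ sum-mono-≤ (λ a → at a (p ≟ a)) ⟩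
      sum g                                                          ∎

  -- Rotating the rim brings an edge that moves `x` to the front; neither the trace nor the number
  -- of fixed colours changes.
  trace-even-moved : ∀ (x : Fin m) j σs → length σs ≡ double (suc j) → fixedByAll x σs ≡ false →
    s * evenCoeff r′ (suc j) + #fixed σs + oddCoeff r′ j ≤ trace x σs
  trace-even-moved x j σs len moved with moved-split x σs moved
  ... | pre , σ , post , refl , q≢x = begin
    s * G + #fixed (pre ++ σ ∷ post) + O   ≡⟨ cong (λ t → s * G + t + O) (sum-cong-≗ (λ a → cong ind (fixedByAll-++-comm a pre (σ ∷ post)))) ⟩
    s * G + #fixed (σ ∷ post ++ pre) + O   ≤⟨ trace-even-moved-head x j σ (post ++ pre) (trans (length-++-comm (σ ∷ post) pre) len) q≢x ⟩
    trace x (σ ∷ post ++ pre)              ≡⟨ trace-++-comm x (σ ∷ post) pre ⟩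
    trace x (pre ++ σ ∷ post)              ∎
    where
    open ≤-Reasoning
    G = evenCoeff r′ (suc j)
    O = oddCoeff r′ j

  -- Every hub colour is compared with the same value `s * G + F + o`. A moved colour reaches it
  -- because its surplus is at least `o`; a fixed colour misses it by at most `suc o`, which is
  -- charged once for each of the `F` fixed colours. The parameter `o` will be `s` for at least four
  -- colours and 1 for three.
  total-even-≥ : ∀ j σs → length σs ≡ double (suc j) → ∀ o → o ≤ oddCoeff r′ j →
    m * (s * evenCoeff r′ (suc j) + #fixed σs + o) ≤ total σs + #fixed σs * suc o
  total-even-≥ j σs len o o≤ = begin
    m * (s * G + F + o)                                             ≡⟨ sym (sum-const m (s * G + F + o)) ⟩
    sum {m} (λ _ → s * G + F + o)                                   ≤⟨ sum-mono-≤ at ⟩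
    sum (λ x → trace x σs + ind (fixedByAll x σs) * suc o)          ≡⟨ ∑-distrib-+ (λ x → trace x σs) (λ x → ind (fixedByAll x σs) * suc o) ⟩
    total σs + sum (λ x → ind (fixedByAll x σs) * suc o)            ≡⟨ cong (total σs +_) (sym (*-distribʳ-sum (suc o) (λ x → ind (fixedByAll x σs)))) ⟩
    total σs + F * suc o                                            ∎
    where
    open ≤-Reasoning
    G = evenCoeff r′ (suc j)
    F = #fixed σs
    lem : ∀ t u → t + 1 + u ≡ t + (1 * suc u)
    lem = solve-∀
    by-cases : ∀ x t → fixedByAll x σs ≡ t → s * G + F + o ≤ trace x σs + ind t * suc o
    by-cases x true  _  = ≤-trans (+-monoˡ-≤ o (trace-even-≥ x j σs len)) (≤-reflexive (lem (trace x σs) o))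
    by-cases x false eq = ≤-trans (+-monoʳ-≤ (s * G + F) o≤) (≤-trans (trace-even-moved x j σs len eq) (m≤m+n _ 0))
    at : ∀ x → s * G + F + o ≤ trace x σs + ind (fixedByAll x σs) * suc o
    at x = by-cases x (fixedByAll x σs) refl

  total-odd-≥ : ∀ j σs → length σs ≡ suc (double j) → m * (s * oddCoeff r′ j) ≤ total σs + m * s
  total-odd-≥ j σs len = begin
    m * (s * O)                           ≡⟨ sym (sum-const m (s * O)) ⟩
    sum {m} (λ _ → s * O)                 ≤⟨ sum-mono-≤ (λ x → trace-odd-≥ x j σs len) ⟩
    sum (λ x → trace x σs + s)            ≡⟨ ∑-distrib-+ (λ x → trace x σs) (λ _ → s) ⟩
    total σs + sum {m} (λ _ → s)          ≡⟨ cong (total σs +_) (sum-const m s) ⟩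
    total σs + m * s                      ∎
    where
    open ≤-Reasoning
    O = oddCoeff r′ j

  module _ (ιs : List (Permutation′ m)) (trivial : ∀ a → All (Fixes a) ιs) where

    private
      fixed : ∀ x → fixedPoints x (composite ιs) ≡ s
      fixed x = fixedPoints-id x (composite ιs) (λ a → composite-fixes (trivial a))

    -- The list `ιs` stands for the natural cover. Its composite fixes all `s` colours, so the
    -- estimate of `total-odd-≥` becomes an equality.
    total-trivial-odd : ∀ j → length ιs ≡ suc (double j) → total ιs + m * s ≡ m * (s * oddCoeff r′ j)
    total-trivial-odd j len = begin
      total ιs + m * s                      ≡⟨ cong (total ιs +_) (sym (sum-const m s)) ⟩
      total ιs + sum {m} (λ _ → s)          ≡⟨ sym (∑-distrib-+ (λ x → trace x ιs) (λ _ → s)) ⟩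
      sum (λ x → trace x ιs + s)            ≡⟨ sum-cong-≗ (λ x → trans (cong (trace x ιs +_) (sym (fixed x))) (trace-odd x j ιs len (trivial x))) ⟩
      sum {m} (λ _ → s * O)                 ≡⟨ sum-const m (s * O) ⟩
      m * (s * O)                           ∎
      where
      open ≡-Reasoning
      O = oddCoeff r′ j

    total-trivial-even : ∀ j → length ιs ≡ double (suc j) → total ιs ≡ m * (s * evenCoeff r′ (suc j) + s)
    total-trivial-even j len = trans
      (sum-cong-≗ (λ x → trans (trace-even x j ιs len (trivial x)) (cong (s * evenCoeff r′ (suc j) +_) (fixed x))))
      (sum-const m (s * evenCoeff r′ (suc j) + s))

    total-trivial-odd-≤ : ∀ j σs → length ιs ≡ suc (double j) → length σs ≡ suc (double j) → total ιs ≤ total σs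
    total-trivial-odd-≤ j σs lenι lenσ = +-cancelʳ-≤ (m * s) _ _
      (≤-trans (≤-reflexive (total-trivial-odd j lenι)) (total-odd-≥ j σs lenσ))

    total-trivial-even-≤ : 1 ≤ r′ → ∀ j σs → length ιs ≡ double (suc (suc j)) → length σs ≡ double (suc (suc j)) →
      total ιs ≤ total σs
    total-trivial-even-≤ 1≤r′ j σs lenι lenσ = +-cancelʳ-≤ (F * m) _ _ (begin
      total ιs + F * m              ≡⟨ cong (_+ F * m) (total-trivial-even (suc j) lenι) ⟩
      m * (s * G + s) + F * m       ≡⟨ lem m (s * G) s F ⟩
      -- With `o = s` the charge per fixed colour is `suc s = m`, exactly what the term `F`
      -- contributes on the left, so `F * m` cancels.
      m * (s * G + F + s)           ≤⟨ total-even-≥ (suc j) σs lenσ s s≤O ⟩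
      total σs + F * m              ∎)
      where
      open ≤-Reasoning
      G = evenCoeff r′ (suc (suc j))
      F = #fixed σs
      lem : ∀ a b c e → a * (b + c) + e * a ≡ a * (b + e + c)
      lem = solve-∀
      -- The coefficient is `1 + r * evenCoeff r′ (suc j)`, and `evenCoeff r′ (suc j)` is at least
      -- `r′`, hence positive. This is where four colours and a rim of length at least 4 enter.
      s≤O : s ≤ oddCoeff r′ (suc j)
      s≤O = s≤s (≤-trans (≤-reflexive (sym (*-identityʳ r))) (*-monoʳ-≤ r (≤-trans 1≤r′ (m≤m+n r′ _))))

-- For three colours `r′ = 0`, every `oddCoeff` is 1, and `o = 1` is the largest choice. The bound
-- then leaves a surplus of `F + 6 * G` over 3, which is dropped.
three≤total : ∀ j (σs : List (Permutation′ 3)) → length σs ≡ double (suc j) → 3 ≤ total σs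
three≤total j σs len = +-cancelʳ-≤ (F * 2) 3 (total σs) (begin
  3 + F * 2                           ≤⟨ m≤m+n (3 + F * 2) (F + 6 * G) ⟩
  3 + F * 2 + (F + 6 * G)             ≡⟨ lem F G ⟩
  3 * (2 * G + F + 1)                 ≤⟨ total-even-≥ 0 j σs len 1 (s≤s z≤n) ⟩
  total σs + F * 2                    ∎)
  where
  open ≤-Reasoning
  G = evenCoeff 0 (suc j)
  F = #fixed σs
  lem : ∀ F G → 3 + F * 2 + (F + 6 * G) ≡ 3 * (2 * G + F + 1)
  lem = solve-∀

-- Finite cardinalities, and closed walks as a finite type.

↔-injective : ∀ {A B : Set} (e : A ↔ B) {x y} → to e x ≡ to e y → x ≡ y
↔-injective e eq = trans (sym (strictlyInverseʳ e _)) (trans (cong (from e) eq) (strictlyInverseʳ e _))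

card-≤ : ∀ {A B : Set} {p q} → HasCard A p → HasCard B q →
  (f : A → B) → (∀ {x y} → f x ≡ f y → x ≡ y) → p ≤ q
card-≤ cA cB f f-inj = injective⇒≤ {f = from cB ∘ f ∘ to cA}
  (λ eq → ↔-injective cA (f-inj (↔-injective (↔-sym cB) eq)))

card-T : ∀ b → HasCard (T b) (ind b)
card-T true  = 1↔⊤
card-T false = 0↔⊥

card-Σ : ∀ {k} {A : Fin k → Set} {f : Fin k → ℕ} → (∀ i → HasCard (A i) (f i)) → HasCard (Σ (Fin k) A) (sum f)
card-Σ {zero}  c = mk↔ₛ′ (λ ()) (λ ()) (λ ()) (λ ())
card-Σ {suc k} {A} c = ↔-trans +↔⊎ (↔-trans (c zero ⊎-↔ card-Σ (c ∘ suc)) split)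
  where
  split : (A zero ⊎ Σ (Fin k) (A ∘ suc)) ↔ Σ (Fin (suc k)) A
  split = mk↔ₛ′ (λ { (inj₁ a) → zero , a ; (inj₂ (i , a)) → suc i , a })
                (λ { (zero , a) → inj₁ a ; (suc i , a) → inj₂ (i , a) })
                (λ { (zero , a) → refl ; (suc i , a) → refl })
                (λ { (inj₁ a) → refl ; (inj₂ (i , a)) → refl })

Σ-T-≡ : ∀ {A : Set} {B : A → Bool} {p q : Σ A (T ∘ B)} → proj₁ p ≡ proj₁ q → p ≡ q
Σ-T-≡ {p = a , t} {.a , u} refl = cong (a ,_) (T-irrelevant t u)

-- The recursion copies that of `walks`, so the cardinality is read off clause by clause; Boolean
-- conditions make walks with the same colours equal.
Walk : ∀ {m} → Fin m → List (Permutation′ m) → Fin m → Fin m → Set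
Walk     x []       a b = T (does (a ≟ b))
Walk {m} x (σ ∷ σs) a b = Σ (Fin m) (λ c → T (allowed x σ a c) × Walk x σs c b)

ClosedWalk : ∀ {m} → List (Permutation′ m) → Set
ClosedWalk {m} σs = Σ (Fin m) (λ x → Σ (Fin m) (λ a → Walk x σs a a))

card-Walk : ∀ {m} (x : Fin m) σs a b → HasCard (Walk x σs a b) (walks x σs a b)
card-Walk x []       a b = card-T (does (a ≟ b))
card-Walk x (σ ∷ σs) a b = card-Σ (λ c → ↔-trans *↔× (card-T (allowed x σ a c) ×-↔ card-Walk x σs c b))

card-ClosedWalk : ∀ {m} (σs : List (Permutation′ m)) → HasCard (ClosedWalk σs) (total σs)
card-ClosedWalk σs = card-Σ (λ x → card-Σ (λ a → card-Walk x σs a a))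

does-sound : ∀ {A : Set} (a? : Dec A) → T (does a?) → A
does-sound (yes a) _ = a

does-complete : ∀ {A : Set} (a? : Dec A) → A → T (does a?)
does-complete a? a rewrite dec-true a? a = tt

allowed-sound : ∀ {m} (x : Fin m) σ a b → T (allowed x σ a b) → a ≢ x × σ ⟨$⟩ʳ a ≢ b
allowed-sound x σ a b t with a ≟ x | b ≟ x | σ ⟨$⟩ʳ a ≟ b
... | no p | no _ | no q = p , q

allowed-complete : ∀ {m} (x : Fin m) σ a b → a ≢ x → b ≢ x → σ ⟨$⟩ʳ a ≢ b → T (allowed x σ a b)
allowed-complete x σ a b p q r rewrite allowed-≢ {σ = σ} p q | dec-false (σ ⟨$⟩ʳ a ≟ b) r = tt

module _ {m : ℕ} {x : Fin m} where

  -- Positions are natural numbers, so that they can be compared with rim indices modulo `n`; past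
  -- the end the last colour is repeated.
  visit : ∀ σs {a b} → Walk x σs a b → ℕ → Fin m
  visit []       {a} w           k       = a
  visit (σ ∷ σs) {a} w           zero    = a
  visit (σ ∷ σs)     (c , _ , w) (suc k) = visit σs w k

  visit-zero : ∀ σs {a b} (w : Walk x σs a b) → visit σs w 0 ≡ a
  visit-zero []       w = refl
  visit-zero (σ ∷ σs) w = refl

  visit-end : ∀ σ n {a b} (w : Walk x (applyUpTo σ n) a b) → visit (applyUpTo σ n) w n ≡ b
  visit-end σ zero    {a} {b} w     = does-sound (a ≟ b) w
  visit-end σ (suc n) (c , _ , w)   = visit-end (σ ∘ suc) n w

  visit-allowed : ∀ σ n {a b} (w : Walk x (applyUpTo σ n) a b) {k} → k < n →
    T (allowed x (σ k) (visit (applyUpTo σ n) w k) (visit (applyUpTo σ n) w (suc k)))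
  visit-allowed σ (suc n) {a} (c , t , w) {zero} _ =
    subst (λ d → T (allowed x (σ 0) a d)) (sym (visit-zero (applyUpTo (σ ∘ suc) n) w)) t
  visit-allowed σ (suc n) (c , t , w) {suc k} (s≤s k<n) = visit-allowed (σ ∘ suc) n w k<n

  visit-injective : ∀ σ n {a b} (v w : Walk x (applyUpTo σ n) a b) →
    (∀ {k} → k ≤ n → visit (applyUpTo σ n) v k ≡ visit (applyUpTo σ n) w k) → v ≡ w
  visit-injective σ zero    v w eq = T-irrelevant v w
  visit-injective σ (suc n) (c , t , v) (d , u , w) eq
    with trans (sym (visit-zero (applyUpTo (σ ∘ suc) n) v)) (trans (eq (s≤s z≤n)) (visit-zero (applyUpTo (σ ∘ suc) n) w))
  ... | refl = cong₂ (λ t w → c , t , w) (T-irrelevant t u) (visit-injective (σ ∘ suc) n v w (eq ∘ s≤s))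

  mkWalk : ∀ σ n (at : ℕ → Fin m) {b} → (∀ {k} → k < n → T (allowed x (σ k) (at k) (at (suc k)))) →
    at n ≡ b → Walk x (applyUpTo σ n) (at 0) b
  mkWalk σ zero    at {b} ok end = does-complete (at 0 ≟ b) end
  mkWalk σ (suc n) at     ok end = at 1 , ok (s≤s z≤n) , mkWalk (σ ∘ suc) n (at ∘ suc) (ok ∘ s≤s) end

  visit-mkWalk : ∀ σ n (at : ℕ → Fin m) {b}
    (ok : ∀ {k} → k < n → T (allowed x (σ k) (at k) (at (suc k)))) (end : at n ≡ b) {k} → k ≤ n →
    visit (applyUpTo σ n) (mkWalk σ n at ok end) k ≡ at k
  visit-mkWalk σ zero    at ok end {zero}  _        = refl
  visit-mkWalk σ (suc n) at ok end {zero}  _        = refl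
  visit-mkWalk σ (suc n) at ok end {suc k} (s≤s k≤n) = visit-mkWalk (σ ∘ suc) n (at ∘ suc) (ok ∘ s≤s) end k≤n

-- Boolean tests, and the pigeonhole principle.

allFinB-sound : ∀ n {f} → T (allFinB n f) → ∀ i → T (f i)
allFinB-sound (suc n) t zero    = proj₁ (Equivalence.to T-∧ t)
allFinB-sound (suc n) t (suc i) = allFinB-sound n (proj₂ (Equivalence.to T-∧ t)) i

allFinB-complete : ∀ n {f} → (∀ i → T (f i)) → T (allFinB n f)
allFinB-complete zero    t = tt
allFinB-complete (suc n) t = Equivalence.from T-∧ (t zero , allFinB-complete n (t ∘ suc))

allFinB-cong : ∀ n {f g} → (∀ i → f i ≡ g i) → allFinB n f ≡ allFinB n g
allFinB-cong zero    eq = refl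
allFinB-cong (suc n) eq = cong₂ _∧_ (eq zero) (allFinB-cong n (eq ∘ suc))

T-not : ∀ {b} → T (not b) → b ≢ true
T-not {false} _ ()

not-T : ∀ {b} → b ≢ true → T (not b)
not-T {false} _ = tt
not-T {true}  p = ⊥-elim (p refl)

T-true : ∀ {b} → T b → b ≡ true
T-true {true} _ = refl

true-T : ∀ {b} → b ≡ true → T b
true-T refl = tt

T-iff : ∀ {b c} → (T b → T c) → (T c → T b) → b ≡ c
T-iff {false} {false} _ _ = refl
T-iff {false} {true}  _ g = ⊥-elim (g tt)
T-iff {true}  {false} f _ = ⊥-elim (f tt)
T-iff {true}  {true}  _ _ = refl

lookup-ext : ∀ {A : Set} {n} {xs ys : Vec A n} → (∀ i → lookup xs i ≡ lookup ys i) → xs ≡ ys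
lookup-ext {xs = xs} {ys} eq = trans (sym (tabulate∘lookup xs)) (trans (tabulate-cong eq) (tabulate∘lookup ys))

-- If `y` were missed, punching it out would inject `Fin (suc n)` into `Fin n`.
injective⇒surjective : ∀ {n} (f : Fin n → Fin n) → (∀ {i j} → f i ≡ f j → i ≡ j) → ∀ y → ∃ λ i → f i ≡ y
injective⇒surjective {suc n} f inj y with any? (λ i → f i ≟ y)
... | yes p = p
... | no ¬p = contradiction (injective⇒≤ {f = λ i → punchOut (missed i)} (λ eq → inj (punchOut-injective (missed _) (missed _) eq))) 1+n≰n
  where
  missed : ∀ i → y ≢ f i
  missed i eq = ¬p (i , sym eq)

-- Colourings of a cover as vectors of colour names.

card-Subset : ∀ {n} (S : Subset n) → HasCard (Σ (Fin n) (T ∘ lookup S)) ∣ S ∣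
card-Subset S = subst (HasCard _) (size-sum S) (card-Σ (card-T ∘ lookup S))
  where
  size-sum : ∀ {n} (S : Subset n) → sum (ind ∘ lookup S) ≡ ∣ S ∣
  size-sum []          = refl
  size-sum (true ∷ S)  = cong suc (size-sum S)
  size-sum (false ∷ S) = size-sum S

-- Coordinates on a cover: a bijection between the vertices of `H` and pairs of a vertex of `G` and
-- a colour, compatible with `part`.
record Labelling {G : Graph} (𝓗 : Cover G) (m : ℕ) : Set where
  field
    vertex    : Fin (size G) → Fin m → HV 𝓗
    label     : HV 𝓗 → Fin m
    part-vertex   : ∀ u a → part 𝓗 (vertex u a) ≡ u
    label-vertex  : ∀ u a → label (vertex u a) ≡ a
    vertex-label  : ∀ y → vertex (part 𝓗 y) (label y) ≡ y

  vertex-injective : ∀ {u a b} → vertex u a ≡ vertex u b → a ≡ b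
  vertex-injective {u} {a} {b} eq = trans (sym (label-vertex u a)) (trans (cong label eq) (label-vertex u b))

  independent : Vec (Fin m) (size G) → Bool
  independent c = allFinB (size G) λ u → allFinB (size G) λ v →
    not (E 𝓗 (vertex u (lookup c u)) (vertex v (lookup c v)))

  independent-sound : ∀ c → T (independent c) → ∀ u v → E 𝓗 (vertex u (lookup c u)) (vertex v (lookup c v)) ≢ true
  independent-sound c t u v = T-not (allFinB-sound (size G) (allFinB-sound (size G) t u) v)

  independent-complete : ∀ c → (∀ u v → E 𝓗 (vertex u (lookup c u)) (vertex v (lookup c v)) ≢ true) → T (independent c)
  independent-complete c f = allFinB-complete (size G) λ u → allFinB-complete (size G) λ v → not-T (f u v)

  private
    n N : ℕ
    n = size G
    N = size (graph (H 𝓗))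

    choice : Vec (Fin m) n → Fin N → Fin N
    choice c y = vertex (part 𝓗 y) (lookup c (part 𝓗 y))

  transversal : Vec (Fin m) n → Subset N
  transversal c = tabulate (λ y → does (choice c y ≟ y))

  private
    ∈-transversal : ∀ c {y} → T (lookup (transversal c) y) → choice c y ≡ y
    ∈-transversal c {y} t = does-sound (choice c y ≟ y) (subst T (lookup∘tabulate _ y) t)

    transversal-∈ : ∀ c {y} → choice c y ≡ y → T (lookup (transversal c) y)
    transversal-∈ c {y} eq = subst T (sym (lookup∘tabulate _ y)) (does-complete (choice c y ≟ y) eq)

    choice-vertex : ∀ c u → choice c (vertex u (lookup c u)) ≡ vertex u (lookup c u)
    choice-vertex c u = cong (λ v → vertex v (lookup c v)) (part-vertex u (lookup c u))

    transversal-card : ∀ c → ∣ transversal c ∣ ≡ n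
    transversal-card c = sym (↔⇒≡ (↔-trans bij (↔-sym (card-Subset (transversal c)))))
      where
      bij : Fin n ↔ Σ (Fin N) (T ∘ lookup (transversal c))
      bij = mk↔ₛ′ (λ u → vertex u (lookup c u) , transversal-∈ c (choice-vertex c u))
                  (part 𝓗 ∘ proj₁)
                  (λ { (y , t) → Σ-T-≡ (∈-transversal c t) })
                  (λ u → part-vertex u (lookup c u))

    transversal-colouring : ∀ c → T (independent c) → T (isHColoring 𝓗 (transversal c))
    transversal-colouring c ind-c = Equivalence.from T-∧
      ( ≡⇒≡ᵇ _ _ (transversal-card c)
      , allFinB-complete N λ y → allFinB-complete N λ z → not-T (no-edge y z))
      where
      no-edge : ∀ y z → (lookup (transversal c) y ∧ lookup (transversal c) z ∧ E 𝓗 y z) ≢ true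
      no-edge y z eq with Equivalence.to T-∧ (true-T eq)
      ... | ty , t with Equivalence.to T-∧ t
      ...   | tz , e = independent-sound c ind-c (part 𝓗 y) (part 𝓗 z)
        (trans (cong₂ (E 𝓗) (∈-transversal c ty) (∈-transversal c tz)) (T-true e))

    module Colouring (S : Subset N) (col : T (isHColoring 𝓗 S)) where

      edge-free : ∀ {y z} → T (lookup S y) → T (lookup S z) → E 𝓗 y z ≢ true
      edge-free {y} {z} ty tz e =
        T-not (allFinB-sound N (allFinB-sound N (proj₂ (Equivalence.to (T-∧ {∣ S ∣ ≡ᵇ n}) col)) y) z)
          (T-true (Equivalence.from T-∧ (ty , Equivalence.from T-∧ (tz , true-T e))))

      part-unique : ∀ {y z} → T (lookup S y) → T (lookup S z) → part 𝓗 y ≡ part 𝓗 z → y ≡ z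
      part-unique {y} {z} ty tz eq with y ≟ z
      ... | yes p = p
      ... | no ¬p = contradiction (complete 𝓗 y z eq ¬p) (edge-free ty tz)

      members : HasCard (Σ (Fin N) (T ∘ lookup S)) n
      members = subst (HasCard _) (≡ᵇ⇒≡ _ _ (proj₁ (Equivalence.to T-∧ col))) (card-Subset S)

      -- Each part is a clique, so `part` is injective on the independent set `S`; since `S` has as
      -- many elements as there are parts, it meets every part.
      member-of : ∀ u → ∃ λ y → T (lookup S y) × part 𝓗 y ≡ u
      member-of u with injective⇒surjective (part 𝓗 ∘ proj₁ ∘ to members)
        (λ eq → ↔-injective members (Σ-T-≡ (part-unique (proj₂ (to members _)) (proj₂ (to members _)) eq))) u
      ... | i , eq = proj₁ (to members i) , proj₂ (to members i) , eq

      labels : Vec (Fin m) n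
      labels = tabulate (λ u → label (proj₁ (member-of u)))

      vertex-labels : ∀ u → vertex u (lookup labels u) ≡ proj₁ (member-of u)
      vertex-labels u = trans (cong (vertex u) (lookup∘tabulate _ u))
        (trans (cong (λ v → vertex v (label y)) (sym (proj₂ (proj₂ (member-of u))))) (vertex-label y))
        where y = proj₁ (member-of u)

      labels-independent : T (independent labels)
      labels-independent = independent-complete labels λ u v e →
        edge-free (proj₁ (proj₂ (member-of u))) (proj₁ (proj₂ (member-of v)))
          (trans (sym (cong₂ (E 𝓗) (vertex-labels u) (vertex-labels v))) e)

      transversal-labels : transversal labels ≡ S
      transversal-labels = lookup-ext λ y → T-iff
        (λ t → subst (T ∘ lookup S) (trans (sym (vertex-labels (part 𝓗 y))) (∈-transversal labels t))
                 (proj₁ (proj₂ (member-of (part 𝓗 y)))))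
        (λ t → transversal-∈ labels (trans (vertex-labels (part 𝓗 y))
                 (part-unique (proj₁ (proj₂ (member-of (part 𝓗 y)))) t (proj₂ (proj₂ (member-of (part 𝓗 y)))))))

    labels-transversal : ∀ c (col : T (isHColoring 𝓗 (transversal c))) → Colouring.labels (transversal c) col ≡ c
    labels-transversal c col = lookup-ext λ u → vertex-injective (trans (vertex-labels u) (sym (chosen u)))
      where
      open Colouring (transversal c) col
      chosen : ∀ u → vertex u (lookup c u) ≡ proj₁ (member-of u)
      chosen u = trans (cong (λ v → vertex v (lookup c v)) (sym (proj₂ (proj₂ (member-of u)))))
        (∈-transversal c (proj₁ (proj₂ (member-of u))))

  -- Transfers counting from subsets of `H` to vectors, both for the lower bound on an arbitrary
  -- cover and for the explicit covers.
  independent↔colouring : Σ (Vec (Fin m) n) (T ∘ independent) ↔ Σ (Subset N) (T ∘ isHColoring 𝓗)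
  independent↔colouring = mk↔ₛ′
    (λ (c , t) → transversal c , transversal-colouring c t)
    (λ (S , t) → Colouring.labels S t , Colouring.labels-independent S t)
    (λ (S , t) → Σ-T-≡ (Colouring.transversal-labels S t))
    (λ (c , t) → Σ-T-≡ (labels-transversal c (transversal-colouring c t)))

-- Covers with a perfect matching prescribed over every edge.

module _ {G : Graph} (adj-sym : ∀ u v → adj G u v ≡ adj G v u) (adj-irrefl : ∀ u → adj G u u ≡ false)
  {m : ℕ} (shift : Fin (size G) → Fin (size G) → Fin m → Fin m)
  (shift-inverse : ∀ u v a → shift v u (shift u v a) ≡ a) where

  private
    n = size G

    pt : Fin (n * m) → Fin n
    pt y = proj₁ (remQuot {n} m y)

    cl : Fin (n * m) → Fin m
    cl y = proj₂ (remQuot {n} m y)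

    within across edge : Fin (n * m) → Fin (n * m) → Bool
    within y z = does (pt y ≟ pt z) ∧ not (does (y ≟ z))
    across y z = adj G (pt y) (pt z) ∧ does (shift (pt y) (pt z) (cl y) ≟ cl z)
    edge y z = within y z ∨ across y z

    ≟-sym : ∀ {k} (a b : Fin k) → does (a ≟ b) ≡ does (b ≟ a)
    ≟-sym a b = T-iff (λ t → does-complete (b ≟ a) (sym (does-sound (a ≟ b) t)))
                      (λ t → does-complete (a ≟ b) (sym (does-sound (b ≟ a) t)))

    edge-sym : ∀ y z → edge y z ≡ edge z y
    edge-sym y z = cong₂ _∨_ (cong₂ (λ p q → p ∧ not q) (≟-sym (pt y) (pt z)) (≟-sym y z))
      (cong₂ _∧_ (adj-sym (pt y) (pt z)) (T-iff (flip-shift y z) (flip-shift z y)))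
      where
      flip-shift : ∀ y z → T (does (shift (pt y) (pt z) (cl y) ≟ cl z)) → T (does (shift (pt z) (pt y) (cl z) ≟ cl y))
      flip-shift y z t = does-complete (_ ≟ _)
        (trans (cong (shift (pt z) (pt y)) (sym (does-sound (_ ≟ _) t))) (shift-inverse (pt y) (pt z) (cl y)))

    edge-irrefl : ∀ y → edge y y ≡ false
    edge-irrefl y rewrite dec-true (pt y ≟ pt y) refl | dec-true (y ≟ y) refl | adj-irrefl (pt y) = refl

    edge-complete : ∀ y z → pt y ≡ pt z → ¬ (y ≡ z) → edge y z ≡ true
    edge-complete y z p q rewrite dec-true (pt y ≟ pt z) p | dec-false (y ≟ z) q = refl

    edge-across : ∀ y z → pt y ≢ pt z → edge y z ≡ true → adj G (pt y) (pt z) ≡ true × shift (pt y) (pt z) (cl y) ≡ cl z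
    edge-across y z p e rewrite dec-false (pt y ≟ pt z) p with Equivalence.to T-∧ (true-T e)
    ... | t , u = T-true t , does-sound (_ ≟ _) u

    edge-matching : ∀ x y z → pt x ≢ pt y → pt y ≡ pt z → edge x y ≡ true → edge x z ≡ true → y ≡ z
    edge-matching x y z p q e f = begin
      y                        ≡⟨ sym (combine-remQuot {n} m y) ⟩
      combine (pt y) (cl y)    ≡⟨ cong₂ combine q (trans (sym (proj₂ (edge-across x y p e)))
                                    (trans (cong (λ v → shift (pt x) v (cl x)) q)
                                      (proj₂ (edge-across x z (λ eq → p (trans eq (sym q))) f)))) ⟩
      combine (pt z) (cl z)    ≡⟨ combine-remQuot {n} m z ⟩
      z                        ∎
      where open ≡-Reasoning

  -- The vertices are pairs, coded by `combine`; over an edge `u v` colour `a` of `u` is matched to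
  -- colour `shift u v a` of `v`. The inverse law makes this relation symmetric. The identity shift
  -- gives the natural cover, and a twist on one rim edge gives the extremal cover for three
  -- colours.
  shiftCover : Cover G
  shiftCover = record
    { H        = record { graph = record { size = n * m ; adj = edge } ; sym = edge-sym ; irrefl = edge-irrefl }
    ; part     = pt
    ; complete = edge-complete
    ; respects = λ y z p e → proj₁ (edge-across y z p e)
    ; matching = edge-matching
    }

  private
    pt-combine : ∀ u a → pt (combine u a) ≡ u
    pt-combine u a = cong proj₁ (remQuot-combine u a)

    cl-combine : ∀ (u : Fin n) a → cl (combine u a) ≡ a
    cl-combine u a = cong proj₂ (remQuot-combine {n} u a)

    combine-pt-cl : ∀ y → combine (pt y) (cl y) ≡ y
    combine-pt-cl y = combine-remQuot {n} m y

  shiftCover-MFold : MFold m shiftCover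
  shiftCover-MFold u = mk↔ₛ′ (λ a → combine u a , pt-combine u a) (cl ∘ proj₁)
    (λ { (y , refl) → Σ-≡ (combine-pt-cl y) }) (cl-combine u)
    where
    Σ-≡ : ∀ {u} {p q : Σ (Fin (n * m)) (λ y → pt y ≡ u)} → proj₁ p ≡ proj₁ q → p ≡ q
    Σ-≡ {p = y , refl} {.y , refl} refl = refl

  private
    labelling : Labelling shiftCover m
    labelling = record
      { vertex = combine ; label = cl ; part-vertex = pt-combine ; label-vertex = cl-combine ; vertex-label = combine-pt-cl }

  shiftProper : Vec (Fin m) n → Bool
  shiftProper c = allFinB n λ u → allFinB n λ v →
    not (adj G u v ∧ does (shift u v (lookup c u) ≟ lookup c v))

  shiftProper-sound : ∀ c → T (shiftProper c) → ∀ u v → adj G u v ≡ true → shift u v (lookup c u) ≢ lookup c v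
  shiftProper-sound c t u v uv eq = T-not (allFinB-sound n (allFinB-sound n t u) v)
    (T-true (Equivalence.from T-∧ (true-T uv , does-complete (_ ≟ _) eq)))

  private
    -- Clique edges join different colours over one vertex, which a vector never selects together.
    -- The disjunction expresses exactly this, so only the matching edges remain.
    edge-combine : ∀ u v a b → u ≢ v ⊎ a ≡ b → edge (combine u a) (combine v b) ≡ adj G u v ∧ does (shift u v a ≟ b)
    edge-combine u v a b apart = trans
      (cong₂ (λ (u′ , a′) (v′ , b′) → (does (u′ ≟ v′) ∧ not (does (combine u a ≟ combine v b)))
                                        ∨ (adj G u′ v′ ∧ does (shift u′ v′ a′ ≟ b′)))
             (remQuot-combine u a) (remQuot-combine v b))
      (no-within (u ≟ v) apart)
      where
      no-within : (u≟v : Dec (u ≡ v)) → u ≢ v ⊎ a ≡ b →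
        (does u≟v ∧ not (does (combine u a ≟ combine v b))) ∨ (adj G u v ∧ does (shift u v a ≟ b))
          ≡ adj G u v ∧ does (shift u v a ≟ b)
      no-within (no _)     _           = refl
      no-within (yes refl) (inj₁ u≢u)  = contradiction refl u≢u
      no-within (yes refl) (inj₂ refl) rewrite dec-true (combine u a ≟ combine u a) refl = refl

    shiftProper-independent : ∀ c → Labelling.independent labelling c ≡ shiftProper c
    shiftProper-independent c = allFinB-cong n λ u → allFinB-cong n λ v → cong not (edge-combine u v _ _ (apart u v))
      where
      apart : ∀ u v → u ≢ v ⊎ lookup c u ≡ lookup c v
      apart u v with u ≟ v
      ... | yes refl = inj₂ refl
      ... | no u≢v   = inj₁ u≢v

  shiftCover-colourings : ∀ {p} → HasCard (Σ (Vec (Fin m) n) (T ∘ shiftProper)) p → NumHColorings shiftCover p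
  shiftCover-colourings card = ↔-trans card (↔-trans
    (mk↔ₛ′ (λ (c , t) → c , subst T (sym (shiftProper-independent c)) t)
           (λ (c , t) → c , subst T (shiftProper-independent c) t)
           (λ _ → Σ-T-≡ refl) (λ _ → Σ-T-≡ refl))
    (Labelling.independent↔colouring labelling))

-- Extending matchings to permutations, and straightening the spokes.

extend-to-permutation : ∀ {m} (R : Fin m → Fin m → Bool) →
  (∀ {a b c} → R a b ≡ true → R a c ≡ true → b ≡ c) →
  (∀ {a b c} → R a c ≡ true → R b c ≡ true → a ≡ b) →
  Σ (Permutation′ m) λ σ → ∀ {a b} → R a b ≡ true → σ ⟨$⟩ʳ a ≡ b
extend-to-permutation {m} R functional injective = proj₁ (below m) , λ {a} → proj₂ (below m) (toℕ<n a)
  where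
  below : ∀ k → Σ (Permutation′ m) λ σ → ∀ {a b} → toℕ a < k → R a b ≡ true → σ ⟨$⟩ʳ a ≡ b
  below zero    = idₚ , λ ()
  below (suc k) with below k | any? (λ a → any? (λ b → (toℕ a ℕ.≟ k) ×-dec (R a b Bool.≟ true)))
  ... | σ , ok | no none = σ , ok′
    where
    ok′ : ∀ {a b} → toℕ a < suc k → R a b ≡ true → σ ⟨$⟩ʳ a ≡ b
    ok′ {a} {b} a<1+k Rab with m<1+n⇒m<n∨m≡n a<1+k
    ... | inj₁ a<k  = ok a<k Rab
    ... | inj₂ refl = contradiction (a , b , refl , Rab) none
  -- The transposition moves the value at `a₀` to `b₀`. Values already prescribed at smaller colours
  -- survive: they differ from `σ a₀` because `σ` is injective, and from `b₀` because `R` is.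
  ... | σ , ok | yes (a₀ , b₀ , refl , R₀) = σ ∘ₚ transpose (σ ⟨$⟩ʳ a₀) b₀ , ok′
    where
    ok′ : ∀ {a b} → toℕ a < suc (toℕ a₀) → R a b ≡ true → transpose (σ ⟨$⟩ʳ a₀) b₀ ⟨$⟩ʳ (σ ⟨$⟩ʳ a) ≡ b
    ok′ {a} {b} a<1+k Rab with m<1+n⇒m<n∨m≡n a<1+k
    ... | inj₂ a≡a₀ with toℕ-injective a≡a₀
    ...   | refl = trans (transpose-left (σ ⟨$⟩ʳ a) b₀) (functional R₀ Rab)
    ok′ {a} {b} a<1+k Rab | inj₁ a<k = trans
      (transpose-other (a≢a₀ ∘ perm-injective σ) (λ eq → a≢a₀ (injective Rab (subst (λ c → R a₀ c ≡ true) (trans (sym eq) (ok a<k Rab)) R₀))))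
      (ok a<k Rab)
      where
      a≢a₀ : a ≢ a₀
      a≢a₀ refl = <-irrefl refl a<k

E-sym : ∀ {G} (𝓗 : Cover G) y z → E 𝓗 y z ≡ true → E 𝓗 z y ≡ true
E-sym 𝓗 y z e = trans (SimpleGraph.sym (H 𝓗) z y) e

module _ {G : Graph} {𝓗 : Cover G} {m : ℕ} where

  MFold⇒Labelling : MFold m 𝓗 → Labelling 𝓗 m
  MFold⇒Labelling fold = record
    { vertex       = λ u a → proj₁ (to (fold u) a)
    ; label        = λ y → from (fold (part 𝓗 y)) (y , refl)
    ; part-vertex  = λ u a → proj₂ (to (fold u) a)
    ; label-vertex = λ u a → trans (from-any (proj₂ (to (fold u) a))) (strictlyInverseʳ (fold u) a)
    ; vertex-label = λ y → cong proj₁ (strictlyInverseˡ (fold (part 𝓗 y)) (y , refl))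
    }
    where
    from-any : ∀ {u y} (p : part 𝓗 y ≡ u) → from (fold (part 𝓗 y)) (y , refl) ≡ from (fold u) (y , p)
    from-any refl = refl

  relabel : Labelling 𝓗 m → (Fin (size G) → Permutation′ m) → Labelling 𝓗 m
  relabel L ρ = record
    { vertex       = λ u a → vertex u (ρ u ⟨$⟩ʳ a)
    ; label        = λ y → ρ (part 𝓗 y) ⟨$⟩ˡ label y
    ; part-vertex  = λ u a → part-vertex u (ρ u ⟨$⟩ʳ a)
    ; label-vertex = λ u a → trans (cong₂ (λ v b → ρ v ⟨$⟩ˡ b) (part-vertex u (ρ u ⟨$⟩ʳ a)) (label-vertex u (ρ u ⟨$⟩ʳ a))) (inverseˡ (ρ u))
    ; vertex-label = λ y → trans (cong (vertex (part 𝓗 y)) (inverseʳ (ρ (part 𝓗 y)))) (vertex-label y)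
    }
    where open Labelling L

  edges-in-permutation : (L : Labelling 𝓗 m) → let open Labelling L in
    ∀ u v → Σ (Permutation′ m) λ σ → u ≢ v → ∀ {a b} → E 𝓗 (vertex u a) (vertex v b) ≡ true → σ ⟨$⟩ʳ a ≡ b
  edges-in-permutation L u v with u ≟ v
  -- Within one part the edges form a clique; `idₚ` is a placeholder, as containment is claimed only
  -- for distinct vertices.
  ... | yes u≡v = idₚ , λ u≢v → contradiction u≡v u≢v
  ... | no u≢v = proj₁ extended , λ _ → proj₂ extended
    where
    open Labelling L
    apart : ∀ {u v} → u ≢ v → ∀ a b → part 𝓗 (vertex u a) ≢ part 𝓗 (vertex v b)
    apart {u} {v} u≢v a b eq = u≢v (trans (sym (part-vertex u a)) (trans eq (part-vertex v b)))
    together : ∀ u a b → part 𝓗 (vertex u a) ≡ part 𝓗 (vertex u b)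
    together u a b = trans (part-vertex u a) (sym (part-vertex u b))
    extended = extend-to-permutation (λ a b → E 𝓗 (vertex u a) (vertex v b))
      (λ {a} {b} {c} e f → vertex-injective (matching 𝓗 _ _ _ (apart u≢v a b) (together v b c) e f))
      (λ {a} {b} {c} e f → vertex-injective (matching 𝓗 _ _ _ (apart (u≢v ∘ sym) c a) (together u a b) (E-sym 𝓗 _ _ e) (E-sym 𝓗 _ _ f)))

-- The colours of each rim part are renamed through the permutation extending its spoke matching,
-- while the hub keeps its names. Spoke edges may still be absent, so only one implication is
-- asserted.
apex-labelling : ∀ {G m} {𝓗 : Cover (Cone G)} → MFold m 𝓗 →
  Σ (Labelling 𝓗 m) λ L → let open Labelling L in
    ∀ {x i a} → E 𝓗 (vertex zero x) (vertex (suc i) a) ≡ true → a ≡ x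
apex-labelling {G} {m} {𝓗} fold = relabel L ρ , λ {x} {i} {a} e →
  perm-injective (ρ (suc i)) (sym (proj₂ (edges-in-permutation L zero (suc i)) (λ ()) e))
  where
  L = MFold⇒Labelling fold
  ρ : Fin (suc (size G)) → Permutation′ m
  ρ zero    = idₚ
  ρ (suc i) = proj₁ (edges-in-permutation L zero (suc i))

-- Rim indices modulo `n`, and adjacency in the wheel.

toℕ-mod : ∀ k n .{{_ : ℕ.NonZero n}} → toℕ (k mod n) ≡ k % n
toℕ-mod k n = toℕ-fromℕ< (m%n<n k n)

toℕ-mod-< : ∀ {k n} .{{_ : ℕ.NonZero n}} → k < n → toℕ (k mod n) ≡ k
toℕ-mod-< {k} {n} k<n = trans (toℕ-mod k n) (m<n⇒m%n≡m k<n)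

mod-toℕ : ∀ {n} .{{_ : ℕ.NonZero n}} (i : Fin n) → toℕ i mod n ≡ i
mod-toℕ i = toℕ-injective (toℕ-mod-< (toℕ<n i))

module _ {n′ : ℕ} where

  private
    n : ℕ
    n = suc n′

  -- Reduction modulo `n` changes the argument only when `suc k` is `n`, and there closedness
  -- applies.
  next-visited : ∀ {A : Set} (f : ℕ → A) → f n ≡ f 0 → ∀ {k} → k < n → f (suc k % n) ≡ f (suc k)
  next-visited f closed {k} k<n with m≤n⇒m<n∨m≡n k<n
  ... | inj₁ 1+k<n = cong f (m<n⇒m%n≡m 1+k<n)
  ... | inj₂ refl  = trans (cong f (n%n≡0 n)) (sym closed)

  nextOf-sound : ∀ {i j} → T (nextOf n i j) → suc (toℕ i) % n ≡ toℕ j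
  nextOf-sound = ≡ᵇ⇒≡ _ _

  cycleAdj-sound : ∀ {i j} → cycleAdj n i j ≡ true → T (nextOf n i j) ⊎ T (nextOf n j i)
  cycleAdj-sound {i} {j} eq with Equivalence.to T-∧ (true-T eq)
  ... | _ , t = Equivalence.to T-∨ t

  cycleAdj-sym : ∀ i j → cycleAdj n i j ≡ cycleAdj n j i
  cycleAdj-sym i j = cong₂ (λ p q → not p ∧ q)
    (T-iff (λ t → does-complete (j ≟ i) (sym (does-sound (i ≟ j) t))) (λ t → does-complete (i ≟ j) (sym (does-sound (j ≟ i) t))))
    (∨-comm (nextOf n i j) (nextOf n j i))

  cycleAdj-irrefl : ∀ i → cycleAdj n i i ≡ false
  cycleAdj-irrefl i rewrite dec-true (i ≟ i) refl = refl

  coneAdj-sym : ∀ u v → coneAdj (Cycle n) u v ≡ coneAdj (Cycle n) v u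
  coneAdj-sym zero    zero    = refl
  coneAdj-sym zero    (suc j) = refl
  coneAdj-sym (suc i) zero    = refl
  coneAdj-sym (suc i) (suc j) = cycleAdj-sym i j

  coneAdj-irrefl : ∀ u → coneAdj (Cycle n) u u ≡ false
  coneAdj-irrefl zero    = refl
  coneAdj-irrefl (suc i) = cycleAdj-irrefl i

  -- Closed walks give colourings of an arbitrary cover of the wheel.

  module _ {m : ℕ} {𝓗 : Cover (Cone (Cycle n))} (L : Labelling 𝓗 m)
    (spoke : ∀ {x i a} → E 𝓗 (Labelling.vertex L zero x) (Labelling.vertex L (suc i) a) ≡ true → a ≡ x) where

    open Labelling L

    -- Indexed by natural numbers so that `applyUpTo rim n` lists the rim edges in order, the last
    -- one returning to index 0.
    rim : ℕ → Permutation′ m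
    rim k = proj₁ (edges-in-permutation L (suc (k mod n)) (suc (suc k mod n)))

    private
      σs : List (Permutation′ m)
      σs = applyUpTo rim n

      module Colours (closed : ClosedWalk σs) where

        private
          x a : Fin m
          x = proj₁ closed
          a = proj₁ (proj₂ closed)

          w : Walk x σs a a
          w = proj₂ (proj₂ closed)

        at : ℕ → Fin m
        at = visit {x = x} σs {a} {a} w

        colours : Vec (Fin m) (suc n)
        colours = x ∷ tabulate (at ∘ toℕ)

        at-≢x : ∀ i → at (toℕ i) ≢ x
        at-≢x i = proj₁ (allowed-sound x (rim (toℕ i)) _ _ (visit-allowed {x = x} rim n {a} {a} w (toℕ<n i)))

        at-closed : at n ≡ at 0
        at-closed = trans (visit-end {x = x} rim n {a} {a} w) (sym (visit-zero {x = x} σs {a} {a} w))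

        -- All edges of `H` between consecutive rim parts lie in the permutation of that rim edge,
        -- which the walk's step avoids. For the closing edge the step ends at position `n`,
        -- identified with position 0.
        rim-edge-free : ∀ {i j : Fin n} → i ≢ j → T (nextOf n i j) →
          E 𝓗 (vertex (suc i) (at (toℕ i))) (vertex (suc j) (at (toℕ j))) ≢ true
        rim-edge-free {i} {j} i≢j t e = proj₂ (allowed-sound x (rim (toℕ i)) _ _ (visit-allowed {x = x} rim n {a} {a} w (toℕ<n i)))
          (trans (proj₂ (edges-in-permutation L (suc (toℕ i mod n)) (suc (suc (toℕ i) mod n))) apart e′) at-j)
          where
          j-eq : suc (toℕ i) mod n ≡ j
          j-eq = toℕ-injective (trans (toℕ-mod (suc (toℕ i)) n) (nextOf-sound t))
          at-j : at (toℕ j) ≡ at (suc (toℕ i))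
          at-j = trans (cong at (sym (nextOf-sound t))) (next-visited at at-closed (toℕ<n i))
          apart : suc (toℕ i mod n) ≢ suc (suc (toℕ i) mod n)
          apart eq with refl ← trans (sym (cong Fin.suc (mod-toℕ i))) (trans eq (cong suc j-eq)) = i≢j refl
          e′ : E 𝓗 (vertex (suc (toℕ i mod n)) (at (toℕ i))) (vertex (suc (suc (toℕ i) mod n)) (at (toℕ j))) ≡ true
          e′ = trans (cong₂ (λ u v → E 𝓗 (vertex (suc u) (at (toℕ i))) (vertex (suc v) (at (toℕ j)))) (mod-toℕ i) j-eq) e

        edge-free : ∀ u v → E 𝓗 (vertex u (lookup colours u)) (vertex v (lookup colours v)) ≢ true
        edge-free zero zero e with () ← trans (sym (irrefl (H 𝓗) _)) e
        -- A spoke edge would force the rim vertex to carry the hub colour, which the walk avoids.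
        edge-free zero (suc j) e rewrite lookup∘tabulate (at ∘ toℕ) j = at-≢x j (spoke e)
        edge-free (suc i) zero e rewrite lookup∘tabulate (at ∘ toℕ) i = at-≢x i (spoke (E-sym 𝓗 _ _ e))
        edge-free (suc i) (suc j) e rewrite lookup∘tabulate (at ∘ toℕ) i | lookup∘tabulate (at ∘ toℕ) j with i ≟ j
        ... | yes refl with () ← trans (sym (irrefl (H 𝓗) _)) e
        -- Edges of `H` lie only over edges of the wheel, so `i` and `j` are consecutive in one of
        -- the two directions.
        ... | no i≢j with cycleAdj-sound (trans (sym adjacent) (respects 𝓗 _ _ apart e))
          where
          apart : part 𝓗 (vertex (suc i) (at (toℕ i))) ≢ part 𝓗 (vertex (suc j) (at (toℕ j)))
          apart eq with refl ← trans (sym (part-vertex (suc i) _)) (trans eq (part-vertex (suc j) _)) = i≢j refl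
          adjacent : adj (Cone (Cycle n)) (part 𝓗 (vertex (suc i) (at (toℕ i)))) (part 𝓗 (vertex (suc j) (at (toℕ j)))) ≡ cycleAdj n i j
          adjacent = cong₂ (coneAdj (Cycle n)) (part-vertex (suc i) _) (part-vertex (suc j) _)
        ...   | inj₁ t = rim-edge-free i≢j t e
        ...   | inj₂ t = rim-edge-free (i≢j ∘ sym) t (E-sym 𝓗 _ _ e)

      open Colours

      colour : ClosedWalk σs → Σ (Vec (Fin m) (suc n)) (T ∘ independent)
      colour w = colours w , independent-complete (colours w) (edge-free w)

      at-equal-< : ∀ v w → colours v ≡ colours w → ∀ {k} → k < n → at v k ≡ at w k
      at-equal-< v w eq {k} k<n = begin
        at v k                                ≡⟨ cong (at v) (sym (toℕ-mod-< k<n)) ⟩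
        at v (toℕ (k mod n))                  ≡⟨ sym (lookup∘tabulate (at v ∘ toℕ) (k mod n)) ⟩
        lookup (colours v) (suc (k mod n))    ≡⟨ cong (λ c → lookup c (suc (k mod n))) eq ⟩
        lookup (colours w) (suc (k mod n))    ≡⟨ lookup∘tabulate (at w ∘ toℕ) (k mod n) ⟩
        at w (toℕ (k mod n))                  ≡⟨ cong (at w) (toℕ-mod-< k<n) ⟩
        at w k                                ∎
        where open ≡-Reasoning

      at-equal : ∀ v w → colours v ≡ colours w → ∀ {k} → k ≤ n → at v k ≡ at w k
      at-equal v w eq {k} k≤n with m≤n⇒m<n∨m≡n k≤n
      ... | inj₁ k<n  = at-equal-< v w eq k<n
      ... | inj₂ refl = trans (at-closed v) (trans (at-equal-< v w eq (s≤s z≤n)) (sym (at-closed w)))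

      colours-injective : ∀ v w → colours v ≡ colours w → v ≡ w
      colours-injective v@(x , a , v′) w@(y , b , w′) eq = same {x} {a} {y} {b} {v′} {w′} (cong (λ c → lookup c zero) eq)
        (trans (sym (visit-zero {x = x} σs {a} {a} v′)) (trans (at-equal v w eq z≤n) (visit-zero {x = y} σs {b} {b} w′))) (λ {k} → at-equal v w eq {k})
        where
        same : ∀ {x a y b} {v : Walk x σs a a} {w : Walk y σs b b} → x ≡ y → a ≡ b →
          (∀ {k} → k ≤ n → at (x , a , v) k ≡ at (y , b , w) k) → _≡_ {A = ClosedWalk σs} (x , a , v) (y , b , w)
        same {x} {a} {v = v} {w} refl refl eqs = cong (λ w → x , a , w) (visit-injective rim n {a} {a} v w (λ {k} → eqs {k}))

    -- Only an inequality, since the extended permutations may forbid pairs that the cover leaves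
    -- unmatched.
    total≤colourings : ∀ {q} → NumHColorings 𝓗 q → total σs ≤ q
    total≤colourings card = card-≤ (card-ClosedWalk σs) card (to independent↔colouring ∘ colour)
      (λ {v} {w} eq → colours-injective v w (cong proj₁ (↔-injective independent↔colouring {colour v} {colour w} eq)))

-- Supplies a count for the twisted cover before its value is identified as 3.
card-Vec : ∀ {m} n (B : Vec (Fin m) n → Bool) → ∃ λ q → HasCard (Σ (Vec (Fin m) n) (T ∘ B)) q
card-Vec zero B = ind (B []) , ↔-trans (card-T (B []))
  (mk↔ₛ′ ([] ,_) (λ { ([] , t) → t }) (λ { ([] , t) → refl }) (λ _ → refl))
card-Vec {m} (suc n) B = _ , ↔-trans (card-Σ (λ a → proj₂ (card-Vec n (B ∘ (a ∷_))))) (mk↔ₛ′ cons uncons cons-uncons (λ _ → refl))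
  where
  cons : Σ (Fin m) (λ a → Σ (Vec (Fin m) n) (λ c → T (B (a ∷ c)))) → Σ (Vec (Fin m) (suc n)) (T ∘ B)
  cons (a , c , t) = a ∷ c , t
  uncons : Σ (Vec (Fin m) (suc n)) (T ∘ B) → Σ (Fin m) (λ a → Σ (Vec (Fin m) n) (λ c → T (B (a ∷ c))))
  uncons (a ∷ c , t) = a , c , t
  cons-uncons : ∀ c → cons (uncons c) ≡ c
  cons-uncons (a ∷ c , t) = refl

-- The natural cover and proper colourings of the wheel.

isProper-sound : ∀ G {m} c → T (isProper G m c) → ∀ u v → adj G u v ≡ true → lookup c u ≢ lookup c v
isProper-sound G c t u v uv eq = T-not (allFinB-sound (size G) (allFinB-sound (size G) t u) v)
  (T-true (Equivalence.from T-∧ (true-T uv , does-complete (_ ≟ _) eq)))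

module _ (n″ : ℕ) where

  private
    n : ℕ
    n = suc (suc n″)

    G : Graph
    G = Cone (Cycle n)

  total-lower-bound : ∀ {m q} (𝓗 : Cover G) → MFold m 𝓗 → NumHColorings 𝓗 q →
    Σ (List (Permutation′ m)) λ σs → length σs ≡ n × total σs ≤ q
  total-lower-bound 𝓗 fold card =
    let L , spoke = apex-labelling {Cycle n} {𝓗 = 𝓗} fold
    in applyUpTo (rim L spoke) n , length-applyUpTo (rim L spoke) n , total≤colourings L spoke card

  cycleAdj-next : ∀ {k} → k < n → cycleAdj n (k mod n) (suc k mod n) ≡ true
  cycleAdj-next {k} k<n = cong₂ (λ p q → not p ∧ q) (dec-false (k mod n ≟ suc k mod n) distinct)
    (T-true (Equivalence.from (T-∨ {nextOf n (k mod n) (suc k mod n)}) (inj₁ (≡⇒≡ᵇ _ _ next))))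
    where
    next : suc (toℕ (k mod n)) % n ≡ toℕ (suc k mod n)
    next = trans (cong (λ l → suc l % n) (toℕ-mod-< k<n)) (sym (toℕ-mod (suc k) n))
    distinct : k mod n ≢ suc k mod n
    distinct eq with m≤n⇒m<n∨m≡n k<n
    ... | inj₁ 1+k<n = 1+n≢n (sym (trans (sym (toℕ-mod-< k<n)) (trans (cong toℕ eq) (toℕ-mod-< 1+k<n))))
    -- At the wrap-around, `n ≥ 2` makes the last index differ from 0.
    ... | inj₂ refl with () ← trans (sym (toℕ-mod-< k<n)) (trans (cong toℕ eq) (trans (toℕ-mod n n) (n%n≡0 n)))

  module _ {m : ℕ} where

    colourAt : Vec (Fin m) (suc n) → ℕ → Fin m
    colourAt c k = lookup c (suc (k mod n))

    colourAt-ext : ∀ {c d : Vec (Fin m) (suc n)} → lookup c zero ≡ lookup d zero →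
      (∀ {k} → k < n → colourAt c k ≡ colourAt d k) → c ≡ d
    colourAt-ext {c} {d} eq₀ eqs = lookup-ext λ where
      zero    → eq₀
      (suc i) → trans (cong (λ j → lookup c (suc j)) (sym (mod-toℕ i))) (trans (eqs (toℕ<n i)) (cong (λ j → lookup d (suc j)) (mod-toℕ i)))

    colourAt-closed : ∀ c → colourAt c n ≡ colourAt c 0
    colourAt-closed c = cong (λ j → lookup c (suc j)) (toℕ-injective (trans (toℕ-mod n n) (n%n≡0 n)))

    private
      ιs : List (Permutation′ m)
      ιs = applyUpTo (λ _ → idₚ) n

      module _ (c : Vec (Fin m) (suc n)) (t : T (isProper G m c)) where

        x : Fin m
        x = lookup c zero

        step : ∀ {k} → k < n → T (allowed x idₚ (colourAt c k) (colourAt c (suc k)))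
        step {k} k<n = allowed-complete x idₚ _ _ (isProper-sound G c t (suc (k mod n)) zero refl)
          (isProper-sound G c t (suc (suc k mod n)) zero refl)
          (isProper-sound G c t (suc (k mod n)) (suc (suc k mod n)) (cycleAdj-next k<n))

        walkAround : ClosedWalk ιs
        walkAround = x , colourAt c 0 , mkWalk {x = x} (λ _ → idₚ) n (colourAt c) step (colourAt-closed c)

      visited : ClosedWalk ιs → ℕ → Fin m
      visited (x , a , w) = visit {x = x} ιs {a} {a} w

      visited-walkAround : ∀ c t {k} → k < n → visited (walkAround c t) k ≡ colourAt c k
      visited-walkAround c t k<n =
        visit-mkWalk {x = x c t} (λ _ → idₚ) n (colourAt c) (step c t) (colourAt-closed c) (<⇒≤ k<n)

    -- Reading the rim colours in order injects proper colourings into the closed walks for identity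
    -- matchings, whose number bounds that of every other list from below in the cases treated.
    chromatic≤total : ∀ {p} → ChromaticValue G m p → p ≤ total ιs
    chromatic≤total card = card-≤ card (card-ClosedWalk ιs) (λ (c , t) → walkAround c t)
      (λ { {c , t} {d , u} eq → Σ-T-≡ (colourAt-ext (cong proj₁ eq) (λ {k} k<n →
        trans (sym (visited-walkAround c t k<n)) (trans (cong (λ w → visited w k) eq) (visited-walkAround d u k<n)))) })

    -- With the identity shift, `shiftProper` is `isProper` by computation, so the given count is
    -- passed on unchanged.
    canonical : ∀ {p} → ChromaticValue G m p → Σ (Cover G) (λ 𝓗 → MFold m 𝓗 × NumHColorings 𝓗 p)
    canonical card = shiftCover {G} coneAdj-sym coneAdj-irrefl {m} unshifted (λ _ _ _ → refl)
      , shiftCover-MFold {G} coneAdj-sym coneAdj-irrefl {m} unshifted (λ _ _ _ → refl)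
      , shiftCover-colourings {G} coneAdj-sym coneAdj-irrefl {m} unshifted (λ _ _ _ → refl) card
      where
      unshifted : Fin (suc n) → Fin (suc n) → Fin m → Fin m
      unshifted _ _ a = a

  all-id-fixes : ∀ {m} k (a : Fin m) → All (Fixes a) (applyUpTo (λ _ → idₚ) k)
  all-id-fixes zero    a = []
  all-id-fixes (suc k) a = refl ∷ all-id-fixes k a

  DPValue-odd : ∀ r′ j → n ≡ suc (double j) → ∀ p → ChromaticValue G (suc (suc (suc r′))) p → DPValue G (suc (suc (suc r′))) p
  DPValue-odd r′ j n-odd p card = canonical card , λ 𝓗 q fold cardH →
    let σs , len , bound = total-lower-bound 𝓗 fold cardH
    in ≤-trans (chromatic≤total card) (≤-trans
      (total-trivial-odd-≤ r′ (applyUpTo (λ _ → idₚ) n) (all-id-fixes n) j σs (trans (length-applyUpTo (λ _ → idₚ) n) n-odd) (trans len n-odd)) bound)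

  DPValue-even : ∀ r′ j → 1 ≤ r′ → n ≡ double (suc (suc j)) → ∀ p →
    ChromaticValue G (suc (suc (suc r′))) p → DPValue G (suc (suc (suc r′))) p
  DPValue-even r′ j 1≤r′ n-even p card = canonical card , λ 𝓗 q fold cardH →
    let σs , len , bound = total-lower-bound 𝓗 fold cardH
    in ≤-trans (chromatic≤total card) (≤-trans
      (total-trivial-even-≤ r′ (applyUpTo (λ _ → idₚ) n) (all-id-fixes n) 1≤r′ j σs (trans (length-applyUpTo (λ _ → idₚ) n) n-even) (trans len n-even)) bound)

  -- The hub and two consecutive rim vertices form a triangle.
  no-proper-≤2 : ∀ {m} → m ≤ 2 → ∀ (c : Vec (Fin m) (suc n)) → ¬ T (isProper G m c)
  no-proper-≤2 {m} m≤2 c t = <⇒≱ (s≤s m≤2) (injective⇒≤ {f = triangle} (λ {i} {j} → distinct i j))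
    where
    a b : Fin m
    a = colourAt c 0
    b = colourAt c 1
    x≢a : lookup c zero ≢ a
    x≢a = isProper-sound G c t zero (suc (0 mod n)) refl
    x≢b : lookup c zero ≢ b
    x≢b = isProper-sound G c t zero (suc (1 mod n)) refl
    a≢b : a ≢ b
    a≢b = isProper-sound G c t (suc (0 mod n)) (suc (1 mod n)) (cycleAdj-next (s≤s z≤n))
    triangle : Fin 3 → Fin m
    triangle zero             = lookup c zero
    triangle (suc zero)       = a
    triangle (suc (suc zero)) = b
    distinct : ∀ i j → triangle i ≡ triangle j → i ≡ j
    distinct zero             zero             _  = refl
    distinct zero             (suc zero)       eq = contradiction eq x≢a
    distinct zero             (suc (suc zero)) eq = contradiction eq x≢b
    distinct (suc zero)       zero             eq = contradiction (sym eq) x≢a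
    distinct (suc zero)       (suc zero)       _  = refl
    distinct (suc zero)       (suc (suc zero)) eq = contradiction eq a≢b
    distinct (suc (suc zero)) zero             eq = contradiction (sym eq) x≢b
    distinct (suc (suc zero)) (suc zero)       eq = contradiction (sym eq) a≢b
    distinct (suc (suc zero)) (suc (suc zero)) _  = refl

  ChromaticValue-≤2 : ∀ {m} → m ≤ 2 → ChromaticValue G m 0
  ChromaticValue-≤2 m≤2 = mk↔ₛ′ (λ ()) (λ (c , t) → ⊥-elim (no-proper-≤2 m≤2 c t))
    (λ (c , t) → ⊥-elim (no-proper-≤2 m≤2 c t)) (λ ())

  DPValue-≤2 : ∀ {m} → m ≤ 2 → DPValue G m 0
  DPValue-≤2 m≤2 = canonical (ChromaticValue-≤2 m≤2) , λ _ _ _ _ → z≤n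

-- Three colours: a twisted cover of the even wheel with exactly three colourings.

rotate rotate⁻¹ : Fin 3 → Fin 3
rotate zero                = suc zero
rotate (suc zero)          = suc (suc zero)
rotate (suc (suc zero))    = zero
rotate⁻¹ zero              = suc (suc zero)
rotate⁻¹ (suc zero)        = zero
rotate⁻¹ (suc (suc zero))  = suc zero

rotate-inverseˡ : ∀ a → rotate⁻¹ (rotate a) ≡ a
rotate-inverseˡ zero             = refl
rotate-inverseˡ (suc zero)       = refl
rotate-inverseˡ (suc (suc zero)) = refl

rotate-inverseʳ : ∀ a → rotate (rotate⁻¹ a) ≡ a
rotate-inverseʳ zero             = refl
rotate-inverseʳ (suc zero)       = refl
rotate-inverseʳ (suc (suc zero)) = refl

-- Only two colours remain beside `x`, so the untwisted part of the rim alternates between them;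
-- checked exhaustively.
alternating : ∀ (x a b c : Fin 3) → a ≢ x → b ≢ x → c ≢ x → a ≢ b → b ≢ c → a ≡ c
alternating = toWitness {a? = all? λ x → all? λ a → all? λ b → all? λ c →
  ¬? (a ≟ x) →-dec ¬? (b ≟ x) →-dec ¬? (c ≟ x) →-dec ¬? (a ≟ b) →-dec ¬? (b ≟ c) →-dec (a ≟ c)} tt

-- Of the two ways to order the remaining colours, the condition from the twisted edge excludes
-- `b ≡ rotate x`.
first-two : ∀ (x a b : Fin 3) → a ≢ x → b ≢ x → a ≢ b → rotate b ≢ a → a ≡ rotate x × b ≡ rotate (rotate x)
first-two = toWitness {a? = all? λ x → all? λ a → all? λ b →
  ¬? (a ≟ x) →-dec ¬? (b ≟ x) →-dec ¬? (a ≟ b) →-dec ¬? (rotate b ≟ a) →-dec ((a ≟ rotate x) ×-dec (b ≟ rotate (rotate x)))} tt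

module _ (j : ℕ) where

  private
    n″ n′ n : ℕ
    n″ = double (suc j)
    n′ = suc n″
    n = suc n′

    G : Graph
    G = Cone (Cycle n)

    last first : Fin (suc n)
    last  = suc (n′ mod n)
    first = suc (0 mod n)

    index-injective : ∀ {k l} → k < n → l < n → _≡_ {A = Fin (suc n)} (suc (k mod n)) (suc (l mod n)) → k ≡ l
    index-injective k<n l<n eq = trans (sym (toℕ-mod-< k<n)) (trans (cong toℕ (Fin-suc-injective eq)) (toℕ-mod-< l<n))

    n′<n : n′ < n
    n′<n = ≤-refl

    last≢first : last ≢ first
    last≢first eq with () ← index-injective n′<n (s≤s z≤n) eq

    -- Identity matchings except on the closing rim edge, which carries a 3-cycle and its inverse in
    -- the other direction. No colour is fixed by the 3-cycle, so the surplus dropped in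
    -- `three≤total` is 0 for this cover.
    twist : Fin (suc n) → Fin (suc n) → Fin 3 → Fin 3
    twist u v a =
      if does (u ≟ last) ∧ does (v ≟ first) then rotate a else
      if does (u ≟ first) ∧ does (v ≟ last) then rotate⁻¹ a else a

    twist-inverse : ∀ u v a → twist v u (twist u v a) ≡ a
    twist-inverse u v a with u ≟ last | u ≟ first | v ≟ last | v ≟ first
    ... | yes p | yes q | _     | _     = contradiction (trans (sym p) q) last≢first
    ... | _     | _     | yes p | yes q = contradiction (trans (sym p) q) last≢first
    ... | yes _ | no _  | no _  | yes _ = rotate-inverseˡ a
    ... | no _  | yes _ | yes _ | no _  = rotate-inverseʳ a
    ... | yes _ | no _  | yes _ | no _  = refl
    ... | yes _ | no _  | no _  | no _  = refl
    ... | no _  | yes _ | no _  | yes _ = refl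
    ... | no _  | yes _ | no _  | no _  = refl
    ... | no _  | no _  | yes _ | no _  = refl
    ... | no _  | no _  | no _  | yes _ = refl
    ... | no _  | no _  | no _  | no _  = refl

    twist-last : ∀ a → twist last first a ≡ rotate a
    twist-last a rewrite dec-true (last ≟ last) refl | dec-true (first ≟ first) refl = refl

    twist-other : ∀ {u v} → u ≢ last → v ≢ last → ∀ a → twist u v a ≡ a
    twist-other {u} {v} p q a rewrite dec-false (u ≟ last) p | dec-false (v ≟ last) q with does (u ≟ first)
    ... | true  = refl
    ... | false = refl

    twist-onto-last : ∀ {u} → u ≢ last → u ≢ first → ∀ a → twist u last a ≡ a
    twist-onto-last {u} p q a rewrite dec-false (u ≟ last) p | dec-false (u ≟ first) q = refl

    proper : Vec (Fin 3) (suc n) → Bool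
    proper = shiftProper {G} coneAdj-sym coneAdj-irrefl twist twist-inverse

    proper-sound : ∀ c → T (proper c) → ∀ u v → adj G u v ≡ true → twist u v (lookup c u) ≢ lookup c v
    proper-sound = shiftProper-sound {G} coneAdj-sym coneAdj-irrefl twist twist-inverse

    module _ (c : Vec (Fin 3) (suc n)) (t : T (proper c)) where

      x : Fin 3
      x = lookup c zero

      at : ℕ → Fin 3
      at = colourAt n″ c

      at-≢x : ∀ k → at k ≢ x
      at-≢x k eq = proper-sound c t zero (suc (k mod n)) refl (trans untwisted (sym eq))
        where
        untwisted : twist zero (suc (k mod n)) x ≡ x
        untwisted = refl

      at-next : ∀ {k} → suc k < n → at k ≢ at (suc k)
      at-next {k} 1+k<n eq = proper-sound c t (suc (k mod n)) (suc (suc k mod n)) (cycleAdj-next n″ (<⇒≤ 1+k<n)) (trans (untwisted (suc (suc k mod n) ≟ last) (at k)) eq)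
        where
        not-last : suc (k mod n) ≢ last
        not-last p = <-irrefl (cong suc (index-injective (<⇒≤ 1+k<n) n′<n p)) 1+k<n
        untwisted : Dec (suc (suc k mod n) ≡ last) → ∀ a → twist (suc (k mod n)) (suc (suc k mod n)) a ≡ a
        untwisted (no q)  a = twist-other not-last q a
        untwisted (yes q) a = trans (cong (λ v → twist (suc (k mod n)) v a) q) (twist-onto-last not-last not-first a)
          where
          -- The edge could be twisted backwards only if `last` directly followed `first`, that is
          -- on a rim of length 2.
          not-first : suc (k mod n) ≢ first
          not-first p with index-injective (<⇒≤ 1+k<n) (s≤s z≤n) p
          ... | refl with () ← index-injective 1+k<n n′<n q

      at-last : rotate (at n′) ≢ at 0
      at-last eq = proper-sound c t last first (subst (λ i → cycleAdj n (n′ mod n) i ≡ true) closes (cycleAdj-next n″ n′<n))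
        (trans (twist-last (at n′)) eq)
        where
        closes : suc n′ mod n ≡ 0 mod n
        closes = toℕ-injective (trans (toℕ-mod n n) (n%n≡0 n))

      at-period : ∀ {k} → suc (suc k) < n → at k ≡ at (suc (suc k))
      at-period {k} k+2<n = alternating x _ _ _ (at-≢x k) (at-≢x (suc k)) (at-≢x (suc (suc k))) (at-next (<⇒≤ k+2<n)) (at-next k+2<n)

      at-odd : ∀ i → suc (double i) < n → at (suc (double i)) ≡ at 1
      at-odd zero    _   = refl
      at-odd (suc i) lt  = trans (sym (at-period lt)) (at-odd i (<⇒≤ (<⇒≤ lt)))

      -- Here parity enters: `n` is even, so the last position is odd and carries the colour of
      -- position 1. The twisted closing edge then relates the first two rim colours and selects one
      -- of the two alternations.
      at-start : at 0 ≡ rotate x × at 1 ≡ rotate (rotate x)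
      at-start = first-two x (at 0) (at 1) (at-≢x 0) (at-≢x 1) (at-next (s≤s (s≤s z≤n)))
        (λ eq → at-last (trans (cong rotate (at-odd (suc j) n′<n)) eq))

    apex-determines : ∀ c t d u → lookup c zero ≡ lookup d zero → ∀ k → k < n → at c t k ≡ at d u k
    apex-determines c t d u eq zero          _   =
      trans (proj₁ (at-start c t)) (trans (cong rotate eq) (sym (proj₁ (at-start d u))))
    apex-determines c t d u eq (suc zero)    _   =
      trans (proj₂ (at-start c t)) (trans (cong (rotate ∘ rotate) eq) (sym (proj₂ (at-start d u))))
    apex-determines c t d u eq (suc (suc k)) lt  =
      trans (sym (at-period c t lt)) (trans (apex-determines c t d u eq k (<⇒≤ (<⇒≤ lt))) (at-period d u lt))

  three≤colourings : ∀ (𝓗 : Cover G) q → MFold 3 𝓗 → NumHColorings 𝓗 q → 3 ≤ q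
  three≤colourings 𝓗 q fold card =
    let σs , len , bound = total-lower-bound n″ 𝓗 fold card
    in ≤-trans (three≤total (suc j) σs len) bound

  DPValue-3 : DPValue G 3 3
  DPValue-3 = (twisted , fold , subst (NumHColorings twisted) q≡3 (colourings (proj₂ (card-Vec (suc n) proper)))) , three≤colourings
    where
    twisted : Cover G
    twisted = shiftCover {G} coneAdj-sym coneAdj-irrefl twist twist-inverse
    fold : MFold 3 twisted
    fold = shiftCover-MFold {G} coneAdj-sym coneAdj-irrefl twist twist-inverse
    colourings : ∀ {p} → HasCard (Σ (Vec (Fin 3) (suc n)) (T ∘ proper)) p → NumHColorings twisted p
    colourings = shiftCover-colourings {G} coneAdj-sym coneAdj-irrefl twist twist-inverse
    q≡3 : proj₁ (card-Vec (suc n) proper) ≡ 3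
    -- At most 3, because a colouring is determined by its hub colour; at least 3, by the general
    -- bound applied to the twisted cover itself.
    q≡3 = ≤-antisym
      (card-≤ (proj₂ (card-Vec (suc n) proper)) ↔-refl (λ (c , _) → lookup c zero)
        (λ { {c , t} {d , u} eq → Σ-T-≡ (colourAt-ext n″ eq (λ {k} → apex-determines c t d u eq k)) }))
      (three≤colourings twisted _ fold (colourings (proj₂ (card-Vec (suc n) proper))))

-- Parity of the rim length and the division by number of colours.

double≡2* : ∀ k → 2 * k ≡ double k
double≡2* zero    = refl
double≡2* (suc k) = cong suc (trans (+-suc k (k + 0)) (cong suc (double≡2* k)))

theorem1p8 : ∀ (k m : ℕ) → 1 ≤ k → 1 ≤ m →
    (∀ p → ChromaticValue (Cone (Cycle (2 * k + 1))) m p →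
    DPValue (Cone (Cycle (2 * k + 1))) m p) ×
    ((m ≤ 2 → DPValue (Cone (Cycle (2 * k + 2))) m 0) ×
    (m ≡ 3 → DPValue (Cone (Cycle (2 * k + 2))) m 3) ×
    (4 ≤ m → ∀ p → ChromaticValue (Cone (Cycle (2 * k + 2))) m p →
    DPValue (Cone (Cycle (2 * k + 2))) m p))
theorem1p8 (suc j) m _ _ = subst₂ Values
  -- Both rim lengths are rewritten through `double`, whose constructor form exposes `n ≥ 2` and the
  -- parity to the lemmas above.
  (sym (trans (+-comm (2 * suc j) 1) (cong suc (double≡2* (suc j)))))
  (sym (trans (+-comm (2 * suc j) 2) (cong (2 +_) (double≡2* (suc j)))))
  ( odd m
  , (λ m≤2 → DPValue-≤2 (double (suc j)) m≤2)
  , (λ { refl → DPValue-3 j })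
  , even m )
  where
  Values : ℕ → ℕ → Set
  Values n₁ n₂ =
    (∀ p → ChromaticValue (Cone (Cycle n₁)) m p → DPValue (Cone (Cycle n₁)) m p) ×
    ((m ≤ 2 → DPValue (Cone (Cycle n₂)) m 0) ×
     (m ≡ 3 → DPValue (Cone (Cycle n₂)) m 3) ×
     (4 ≤ m → ∀ p → ChromaticValue (Cone (Cycle n₂)) m p → DPValue (Cone (Cycle n₂)) m p))
  n₁ n₂ : ℕ
  n₁ = suc (double (suc j))
  n₂ = suc (suc (double (suc j)))
  small : ∀ {m} → m ≤ 2 → ∀ p → ChromaticValue (Cone (Cycle n₁)) m p → DPValue (Cone (Cycle n₁)) m p
  small {m} m≤2 p card = subst (DPValue (Cone (Cycle n₁)) m) (sym p≡0) (DPValue-≤2 (suc (double j)) m≤2)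
    where
    p≡0 : p ≡ 0
    -- Two cardinalities of the same type agree, so the given chromatic value is the 0 forced by the
    -- triangle.
    p≡0 = n≤0⇒n≡0 (card-≤ card (ChromaticValue-≤2 (suc (double j)) m≤2) (λ c → c) (λ eq → eq))
  odd : ∀ m p → ChromaticValue (Cone (Cycle n₁)) m p → DPValue (Cone (Cycle n₁)) m p
  odd 0                    = small z≤n
  odd 1                    = small (s≤s z≤n)
  odd 2                    = small (s≤s (s≤s z≤n))
  odd (suc (suc (suc r′))) = DPValue-odd (suc (double j)) r′ (suc j) refl
  even : ∀ m → 4 ≤ m → ∀ p → ChromaticValue (Cone (Cycle n₂)) m p → DPValue (Cone (Cycle n₂)) m p
  -- Since `m = r′ + 3`, four colours mean `1 ≤ r′`.
  even (suc (suc (suc r′))) (s≤s (s≤s (s≤s 1≤r′))) = DPValue-even (double (suc j)) r′ j 1≤r′ refl
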